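{- Let $f\in\mathbb{F}[x_1,\dots,x_n]$ be homogeneous of degree $d$. Then $g=\Xi(f)$ is the unique polynomial such that (1) $g-f$ has degree $<d$, and (2) $g(-\overline\eta)=0$ for all compositions $\eta$ with $|\eta|<d$.
   Context: Fix $n\ge1$; $r$ is an indeterminate, $\alpha=1/r$, $\mathbb{F}=\mathbb{Q}(r)$. Compositions are $\eta\in\mathbb{N}^n$, $|\eta|=\sum\eta_i$, $x^\eta=\prod x_i^{\eta_i}$; partitions are weakly decreasing compositions; $\delta=(n-1,\dots,0)$; permutations act on vectors by $(wv)_{w(i)}=v_i$; $w_\gamma$ is the minimal-length permutation with $w_\gamma^{ -1}(\gamma)$ a partition, and $\overline\gamma=\gamma+w_\gamma(r\delta)$. $E_\eta^{r\delta}$ is the unique polynomial of degree $|\eta|$ vanishing at all $\overline\gamma$ with $\gamma\ne\eta$, $|\gamma|\le|\eta|$, with coefficient $1$ on $x^\eta$; $E_\eta^{(\alpha)}$ its top homogeneous component. With $a_\eta(i,j)=\eta_i-j$, $l_\eta(i,j)=\#\{k>i:j\le\eta_k\le\eta_i\}+\#\{k<i:j\le\eta_k+1\le\eta_i\}$, $d_\eta(\alpha)=\prod_{1\le j\le\eta_i}(\alpha(a_\eta(i,j)+1)+l_\eta(i,j)+1)$, set $F_\eta^{(\alpha)}=d_\eta E_\eta^{(\alpha)}$, $F_\eta^{r\delta}(x)=(-1)^{|\eta|}d_\eta E_\eta^{r\delta}(-x)$; $\Xi$ is the unique $\mathbb{F}$-linear operator on $\mathbb{F}[x_1,\dots,x_n]$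 with $\Xi(F_\eta^{(\alpha)})=F_\eta^{r\delta}$ for all $\eta$. -}

module Defs where

open import Data.Rational as ℚ using (ℚ; 0ℚ; 1ℚ)
open import Data.Integer using (+_)
open import Data.Nat as ℕ using (ℕ; zero; suc; _∸_)
open import Data.Fin as Fin using (Fin)
open import Data.List as L using (List; []; _∷_; [_]; _++_; foldr; map; filter; length; allFin; upTo)
open import Data.List.Relation.Unary.All using (All)
open import Data.Vec as V using (Vec)
open import Data.Vec.Properties using (≡-dec)
open import Data.Product using (_×_; _,_; proj₁; proj₂)
open import Data.Bool using (if_then_else_)
open import Relation.Binary.PropositionalEquality using (_≡_; _≢_)
open import Relation.Nullary.Decidable using (does; _×-dec_)

-- ℚ[r]: univariate polynomials over ℚ as coefficient lists (low → high)

QPoly : Set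
QPoly = List ℚ

infixl 6 _⊕_
infixl 7 _⊗_

_⊕_ : QPoly → QPoly → QPoly
[] ⊕ q = q
(a ∷ p) ⊕ [] = a ∷ p
(a ∷ p) ⊕ (b ∷ q) = (a ℚ.+ b) ∷ (p ⊕ q)

scaleQ : ℚ → QPoly → QPoly
scaleQ a = map (a ℚ.*_)

_⊗_ : QPoly → QPoly → QPoly
[] ⊗ q = []
(a ∷ p) ⊗ q = scaleQ a q ⊕ (0ℚ ∷ (p ⊗ q))

⊖_ : QPoly → QPoly
⊖ p = map ℚ.-_ p

IsZeroQ : QPoly → Set
IsZeroQ p = All (_≡ 0ℚ) p

record NZ : Set where
  field
    low    : List ℚ
    lead   : ℚ
    lead≢0 : lead ≢ 0ℚ

toQ : NZ → QPoly
toQ f = NZ.low f ++ [ NZ.lead f ]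

-- product of a list of nonzero polynomials (nonzero, since ℚ[r] is a domain)
prodNZ : List NZ → QPoly
prodNZ = foldr (λ f acc → toQ f ⊗ acc) [ 1ℚ ]

-- 𝔽 = ℚ(r): fractions num / (product of the nonzero polynomials in den)

record 𝔽 : Set where
  constructor _⁄_
  field
    num : QPoly
    den : List NZ

infix 4 _≈_
_≈_ : 𝔽 → 𝔽 → Set
(a ⁄ D) ≈ (b ⁄ E) = IsZeroQ ((a ⊗ prodNZ E) ⊕ ⊖ (b ⊗ prodNZ D))

infixl 6 _+F_
infixl 7 _*F_

_+F_ : 𝔽 → 𝔽 → 𝔽
(a ⁄ D) +F (b ⁄ E) = ((a ⊗ prodNZ E) ⊕ (b ⊗ prodNZ D)) ⁄ (D ++ E)

_*F_ : 𝔽 → 𝔽 → 𝔽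
(a ⁄ D) *F (b ⁄ E) = (a ⊗ b) ⁄ (D ++ E)

-F_ : 𝔽 → 𝔽
-F (a ⁄ D) = (⊖ a) ⁄ D

0F : 𝔽
0F = [] ⁄ []

1F : 𝔽
1F = [ 1ℚ ] ⁄ []

ℕ→F : ℕ → 𝔽
ℕ→F k = [ + k ℚ./ 1 ] ⁄ []

1≢0 : 1ℚ ≢ 0ℚ
1≢0 ()

rNZ : NZ
rNZ = record { low = [ 0ℚ ] ; lead = 1ℚ ; lead≢0 = 1≢0 }

rF : 𝔽
rF = toQ rNZ ⁄ []

αF : 𝔽
αF = [ 1ℚ ] ⁄ [ rNZ ]

powF : 𝔽 → ℕ → 𝔽
powF x zero = 1F
powF x (suc k) = x *F powF x k

signF : ℕ → 𝔽
signF k = powF (-F 1F) k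

∣_∣ : ∀ {n} → Vec ℕ n → ℕ
∣ η ∣ = V.sum η

-- polynomials in x₁ … xₙ over 𝔽, as formal sums of terms (monomial exponent, coefficient)

Poly : ℕ → Set
Poly n = List (Vec ℕ n × 𝔽)

coeff : ∀ {n} → Poly n → Vec ℕ n → 𝔽
coeff p μ = foldr (λ t acc → if does (≡-dec ℕ._≟_ (proj₁ t) μ) then proj₂ t +F acc else acc) 0F p

infix 4 _≈P_
_≈P_ : ∀ {n} → Poly n → Poly n → Set
p ≈P q = ∀ μ → coeff p μ ≈ coeff q μ

infixl 6 _+P_ _-P_
_+P_ : ∀ {n} → Poly n → Poly n → Poly n
p +P q = p ++ q

scaleP : ∀ {n} → 𝔽 → Poly n → Poly n
scaleP c = map (λ t → proj₁ t , c *F proj₂ t)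

_-P_ : ∀ {n} → Poly n → Poly n → Poly n
p -P q = p +P scaleP (-F 1F) q

evalMon : ∀ {n} → Vec 𝔽 n → Vec ℕ n → 𝔽
evalMon x μ = V.foldr _ _*F_ 1F (V.zipWith powF x μ)

eval : ∀ {n} → Poly n → Vec 𝔽 n → 𝔽
eval p x = foldr (λ t acc → proj₂ t *F evalMon x (proj₁ t) +F acc) 0F p

negV : ∀ {n} → Vec 𝔽 n → Vec 𝔽 n
negV = V.map -F_

negArg : ∀ {n} → Poly n → Poly n
negArg = map (λ t → proj₁ t , signF ∣ proj₁ t ∣ *F proj₂ t)

topComp : ∀ {n} → ℕ → Poly n → Poly n
topComp k = filter (λ t → ∣ proj₁ t ∣ ℕ.≟ k)

IsHomog : ∀ {n} → ℕ → Poly n → Set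
IsHomog d f = ∀ μ → ∣ μ ∣ ≢ d → coeff f μ ≈ 0F

-- deg p < d   (the zero polynomial has degree < every d)
DegLt : ∀ {n} → ℕ → Poly n → Set
DegLt d p = ∀ μ → d ℕ.≤ ∣ μ ∣ → coeff p μ ≈ 0F

DegLe : ∀ {n} → ℕ → Poly n → Set
DegLe d p = ∀ μ → d ℕ.< ∣ μ ∣ → coeff p μ ≈ 0F

-- γ̄ = γ + w_γ(rδ)


-- w_γ⁻¹(i) (0-based): the position of i under the minimal-length (stable)
-- sorting of γ into a partition:  #{k : γ_k > γ_i} + #{k < i : γ_k = γ_i}
winv : ∀ {n} → Vec ℕ n → Fin n → ℕ
winv {n} γ i =
  length (filter (λ k → V.lookup γ i ℕ.<? V.lookup γ k) (allFin n))
  ℕ.+ length (filter (λ k → (k Fin.<? i) ×-dec (V.lookup γ k ℕ.≟ V.lookup γ i)) (allFin n))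

-- (γ̄)_i = γ_i + r · δ_{w_γ⁻¹(i)},   δ = (n-1, …, 0)
bar : ∀ {n} → Vec ℕ n → Vec 𝔽 n
bar {n} γ = V.tabulate (λ i → ℕ→F (V.lookup γ i) +F rF *F ℕ→F (n ∸ 1 ∸ winv γ i))

-- E_η^{rδ}: characterised by its defining properties

IsInterp : ∀ {n} → Vec ℕ n → Poly n → Set
IsInterp {n} η E =
  DegLe ∣ η ∣ E
  × coeff E η ≈ 1F
  × (∀ (γ : Vec ℕ n) → γ ≢ η → ∣ γ ∣ ℕ.≤ ∣ η ∣ → eval E (bar γ) ≈ 0F)

legη : ∀ {n} → Vec ℕ n → Fin n → ℕ → ℕ
legη {n} η i j =
  length (filter (λ k → (i Fin.<? k) ×-dec ((j ℕ.≤? V.lookup η k) ×-dec (V.lookup η k ℕ.≤? V.lookup η i))) (allFin n))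
  ℕ.+ length (filter (λ k → (k Fin.<? i) ×-dec ((j ℕ.≤? suc (V.lookup η k)) ×-dec (suc (V.lookup η k) ℕ.≤? V.lookup η i))) (allFin n))

armη : ∀ {n} → Vec ℕ n → Fin n → ℕ → ℕ
armη η i j = V.lookup η i ∸ j

prodF : List 𝔽 → 𝔽
prodF = foldr _*F_ 1F

dη : ∀ {n} → Vec ℕ n → 𝔽
dη {n} η = prodF (L.concatMap
  (λ i → map (λ j0 → let j = suc j0 in
                αF *F ℕ→F (suc (armη η i j)) +F ℕ→F (suc (legη η i j)))
             (upTo (V.lookup η i)))
  (allFin n))

Fα : ∀ {n} → (Vec ℕ n → Poly n) → Vec ℕ n → Poly n
Fα E η = scaleP (dη η) (topComp ∣ η ∣ (E η))

Frδ : ∀ {n} → (Vec ℕ n → Poly n) → Vec ℕ n → Poly n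
Frδ E η = scaleP (signF ∣ η ∣ *F dη η) (negArg (E η))

record IsLinear {n} (Ξ : Poly n → Poly n) : Set where
  field
    cong  : ∀ p q → p ≈P q → Ξ p ≈P Ξ q
    additive : ∀ p q → Ξ (p +P q) ≈P Ξ p +P Ξ q
    homog : ∀ c p → Ξ (scaleP c p) ≈P scaleP c (Ξ p)

{-# OPTIONS --safe #-}

module Submission where

-- Uniqueness rests on unisolvence: a polynomial of degree at most d that vanishes at γ̄ for all
-- |γ| ≤ d is zero. Those γ̄ with γₙ = 0 lie on a hyperplane and reduce to n - 1 variables; the
-- others are images of the γ̄ of smaller degree under x ↦ (x₂, …, xₙ, x₁ + 1), and dividing by
-- the equation of the hyperplane reduces the degree. Consequently E_η(η̄) ≠ 0, so subtracting
-- multiples of the E_η degree by degree expands every polynomial of degree d in the E_η with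
-- |η| ≤ d. Taking top components, a homogeneous f of degree d is a combination of the
-- F_η^{(α)} with |η| = d, and for each of these both properties hold by the definition of
-- F_η^{rδ}.

open import Algebra.Bundles using (CommutativeRing)
open import Algebra.Properties.CommutativeSemigroup using (x∙yz≈y∙xz)
open import Data.Bool using (Bool; true; false; if_then_else_; _∧_)
open import Data.Empty using (⊥-elim)
open import Data.Fin as Fin using (Fin; zero; suc; fromℕ; inject₁; toℕ)
open import Data.Fin.Relation.Unary.Top using (view; ‵fromℕ; ‵inject₁)
open import Data.Integer as ℤ using (+_)
open import Data.Integer.GCD using (gcd)
import Data.Integer.Properties as ℤ
open import Data.List as List
  using (List; []; _∷_; [_]; _++_; map; foldr; filter; length; upTo; allFin; cartesianProductWith)
open import Data.List.Membership.Propositional using (_∈_)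
open import Data.List.Membership.Propositional.Properties
  using (∈-filter⁺; ∈-upTo⁺; ∈-cartesianProductWith⁺)
open import Data.List.Properties using (map-cong)
open import Data.List.Relation.Unary.All as All using (All; []; _∷_)
import Data.List.Relation.Unary.All.Properties as All
open import Data.List.Relation.Unary.Any using (here; there)
open import Data.Nat as ℕ using (ℕ; zero; suc; _≤_; _<_; s≤s; z≤n)
import Data.Nat.Properties as ℕ
open import Data.Nat.Tactic.RingSolver using (solve-∀)
open import Data.Product using (_×_; _,_; proj₁; proj₂; ∃; Σ-syntax)
open import Data.Rational as ℚ using (ℚ; 0ℚ; 1ℚ)
import Data.Rational.Properties as ℚ
import Data.Rational.Unnormalised as ℚᵘ
import Data.Rational.Unnormalised.Properties as ℚᵘ
open import Data.Sum as Sum using (_⊎_; inj₁; inj₂)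
open import Data.Vec as Vec using (Vec; []; _∷_; _∷ʳ_)
open import Data.Vec.Properties using (≡-dec; lookup∘tabulate; lookup-map)
open import Function using (_∘_; id)
open import Level using (0ℓ)
open import Relation.Binary using (Setoid)
open import Relation.Binary.PropositionalEquality as ≡ using (_≡_; _≢_)
open import Relation.Nullary using (¬_; yes; no)
open import Relation.Nullary.Decidable using (does; _×-dec_)
open import Relation.Unary using (Pred; Decidable)

open import Defs using (winv)

-- The abstract domain is instantiated twice. Over ℚ, the univariate theory shows that a polynomial
-- in `r` is determined by its values at the natural numbers, and this is what turns the fractions
-- `𝔽` into a ring without zero divisors; the interpolation argument is then run over `𝔽` itself.
-- The induction for unisolvence depends on two facts about ranks in the sorting of a composition.
-- Appending a last entry 0 raises the rank of every other entry by one, so the nodes on the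
-- hyperplane are not the nodes in fewer variables but their translates by `r` in every coordinate;
-- the induction therefore has to cover all translates by `c r`. Moving a first entry `x` to the end
-- as `x + 1` changes no rank, which gives the affine map. Division by the equation of the
-- hyperplane is possible because that equation takes values `k + 1 + r m` at the remaining nodes,
-- and these are nonzero for an indeterminate `r`. Terms of a formal sum may cancel, so its list of
-- terms does not show its degree; the division is carried out on expressions whose type bounds the
-- degree.

record CharZeroDomain : Set₁ where
  field commutativeRing : CommutativeRing 0ℓ 0ℓ
  open CommutativeRing commutativeRing public hiding (zero; _-_)
  field
    noZeroDivisors : ∀ {x y} → x * y ≈ 0# → x ≈ 0# ⊎ y ≈ 0#
    ι      : ℕ → Carrier
    ι-zero : ι 0 ≈ 0#
    ι-suc  : ∀ k → ι (suc k) ≈ 1# + ι k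
    ι≉0    : ∀ k → ¬ ι (suc k) ≈ 0#

  1≉0 : ¬ 1# ≈ 0#
  1≉0 1≈0 = ι≉0 0 (trans (ι-suc 0) (trans (+-cong 1≈0 ι-zero) (+-identityˡ 0#)))

  x≈0⇒x*y≈0 : ∀ {x} y → x ≈ 0# → x * y ≈ 0#
  x≈0⇒x*y≈0 y x≈0 = trans (*-congʳ x≈0) (zeroˡ y)

  y≈0⇒x*y≈0 : ∀ x {y} → y ≈ 0# → x * y ≈ 0#
  y≈0⇒x*y≈0 x y≈0 = trans (*-congˡ y≈0) (zeroʳ x)

  x≈0⇒x+y≈y : ∀ {x} y → x ≈ 0# → x + y ≈ y
  x≈0⇒x+y≈y y x≈0 = trans (+-congʳ x≈0) (+-identityˡ y)

  y≈0⇒x+y≈x : ∀ x {y} → y ≈ 0# → x + y ≈ x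
  y≈0⇒x+y≈x x y≈0 = trans (+-congˡ y≈0) (+-identityʳ x)

  0+0≈0 : ∀ {x y} → x ≈ 0# → y ≈ 0# → x + y ≈ 0#
  0+0≈0 {_} {y} x≈0 y≈0 = trans (x≈0⇒x+y≈y y x≈0) y≈0

  x≉0∧x*y≈0⇒y≈0 : ∀ {x y} → ¬ x ≈ 0# → x * y ≈ 0# → y ≈ 0#
  x≉0∧x*y≈0⇒y≈0 x≉0 xy≈0 with noZeroDivisors xy≈0
  ... | inj₁ x≈0 = ⊥-elim (x≉0 x≈0)
  ... | inj₂ y≈0 = y≈0

  -- Differences take the form `x + (- 1#) * y` because `_-P_` adds a multiple by `- 1#`.
  x≈y⇒x-y≈0 : ∀ {x y} → x ≈ y → x + (- 1#) * y ≈ 0#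
  x≈y⇒x-y≈0 {x} {y} x≈y = begin
    x + (- 1#) * y ≈⟨ +-congˡ (-1*x≈-x y) ⟩
    x + - y        ≈⟨ +-congʳ x≈y ⟩
    y + - y        ≈⟨ -‿inverseʳ y ⟩
    0#             ∎
    where
    open import Relation.Binary.Reasoning.Setoid setoid
    open import Algebra.Properties.Ring ring using (-1*x≈-x)

  x-y≈0⇒x≈y : ∀ {x y} → x + (- 1#) * y ≈ 0# → x ≈ y
  x-y≈0⇒x≈y {x} {y} eq = sym (begin
    y                    ≈⟨ +-identityˡ y ⟨
    0# + y               ≈⟨ +-congʳ eq ⟨
    x + (- 1#) * y + y   ≈⟨ +-assoc _ _ _ ⟩
    x + ((- 1#) * y + y) ≈⟨ +-congˡ (+-congʳ (-1*x≈-x y)) ⟩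
    x + (- y + y)        ≈⟨ +-congˡ (-‿inverseˡ y) ⟩
    x + 0#               ≈⟨ +-identityʳ x ⟩
    x                    ∎)
    where
    open import Relation.Binary.Reasoning.Setoid setoid
    open import Algebra.Properties.Ring ring using (-1*x≈-x)

  ι-+ : ∀ j k → ι (j ℕ.+ k) ≈ ι j + ι k
  ι-+ zero k = sym (x≈0⇒x+y≈y _ ι-zero)
  ι-+ (suc j) k = begin
    ι (suc (j ℕ.+ k))   ≈⟨ ι-suc _ ⟩
    1# + ι (j ℕ.+ k)    ≈⟨ +-congˡ (ι-+ j k) ⟩
    1# + (ι j + ι k)    ≈⟨ +-assoc _ _ _ ⟨
    1# + ι j + ι k      ≈⟨ +-congʳ (ι-suc j) ⟨
    ι (suc j) + ι k     ∎
    where open import Relation.Binary.Reasoning.Setoid setoid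

-- Univariate polynomials: division by a root and vanishing at the natural numbers.

module UnivariatePolynomials (D : CharZeroDomain) where
  open CharZeroDomain D
  open import Relation.Binary.Reasoning.Setoid setoid
  open import Algebra.Solver.Ring.NaturalCoefficients.Default commutativeSemiring
    using (solve; con; _:=_; _:+_; _:*_)

  horner : List Carrier → Carrier → Carrier
  horner []      x = 0#
  horner (a ∷ p) x = a + x * horner p x

  horner-cong : ∀ p {x y} → x ≈ y → horner p x ≈ horner p y
  horner-cong []      x≈y = refl
  horner-cong (a ∷ p) x≈y = +-congˡ (*-cong x≈y (horner-cong p x≈y))

  horner-zero : ∀ {p} → All (_≈ 0#) p → ∀ x → horner p x ≈ 0#
  horner-zero []         x = refl
  horner-zero (a≈0 ∷ p≈0) x = 0+0≈0 a≈0 (y≈0⇒x*y≈0 x (horner-zero p≈0 x))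

  -- Synthetic division: the quotient of a ∷ t by (x - c), for any a.
  deflate : Carrier → List Carrier → List Carrier
  deflate c []      = []
  deflate c (b ∷ t) = horner (b ∷ t) c ∷ deflate c t

  length-deflate : ∀ c t → length (deflate c t) ≡ length t
  length-deflate c []      = ≡.refl
  length-deflate c (b ∷ t) = ≡.cong suc (length-deflate c t)

  -- With x = e + c, so that no subtraction occurs.
  horner-deflate : ∀ c e t →
    e * horner (deflate c t) (e + c) + c * horner t c ≈ (e + c) * horner t (e + c)
  horner-deflate c e [] = solve 2 (λ c e → e :* con 0 :+ c :* con 0 := (e :+ c) :* con 0) refl c e
  horner-deflate c e (b ∷ t) = begin
    e * ((b + c * H) + (e + c) * Q) + c * (b + c * H)
      ≈⟨ solve 5 (λ b c e H Q → e :* ((b :+ c :* H) :+ (e :+ c) :* Q) :+ c :* (b :+ c :* H)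
           := (e :+ c) :* (b :+ (e :* Q :+ c :* H))) refl b c e H Q ⟩
    (e + c) * (b + (e * Q + c * H))
      ≈⟨ *-congˡ (+-congˡ (horner-deflate c e t)) ⟩
    (e + c) * (b + (e + c) * horner t (e + c)) ∎
    where
    H = horner t c
    Q = horner (deflate c t) (e + c)

  horner-root : ∀ c e a t → horner (a ∷ t) c ≈ 0# →
    horner (a ∷ t) (e + c) ≈ e * horner (deflate c t) (e + c)
  horner-root c e a t root = begin
    a + (e + c) * horner t (e + c)   ≈⟨ +-congˡ (horner-deflate c e t) ⟨
    a + (e * Q + c * horner t c)
      ≈⟨ solve 3 (λ a q h → a :+ (q :+ h) := (a :+ h) :+ q) refl a (e * Q) (c * horner t c) ⟩
    (a + c * horner t c) + e * Q     ≈⟨ x≈0⇒x+y≈y _ root ⟩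
    e * Q                            ∎
    where Q = horner (deflate c t) (e + c)

  deflate-zero : ∀ c t → All (_≈ 0#) (deflate c t) → All (_≈ 0#) t
  deflate-zero c []      []         = []
  deflate-zero c (b ∷ t) (h ∷ hs) =
    trans (sym (y≈0⇒x+y≈x b (y≈0⇒x*y≈0 c (horner-zero t≈0 c)))) h ∷ t≈0
    where t≈0 = deflate-zero c t hs

  root-deflate-zero : ∀ c a t → horner (a ∷ t) c ≈ 0# → All (_≈ 0#) (deflate c t) →
    All (_≈ 0#) (a ∷ t)
  root-deflate-zero c a t root q≈0 =
    trans (sym (y≈0⇒x+y≈x a (y≈0⇒x*y≈0 c (horner-zero t≈0 c)))) root ∷ t≈0
    where t≈0 = deflate-zero c t q≈0

  -- At the point `m + 1 + k` the linear factor divided out has the value `ι (suc k)`, which can be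
  -- cancelled in characteristic zero. The root `m` itself is lost, so the remaining points start at
  -- `suc m`.
  deflate-vanish : ∀ m a s q → horner (a ∷ s) (ι m) ≈ 0# →
    (∀ k → horner (a ∷ s) (ι (k ℕ.+ m)) * horner q (ι (k ℕ.+ m)) ≈ 0#) →
    ∀ k → horner (deflate (ι m) s) (ι (k ℕ.+ suc m)) * horner q (ι (k ℕ.+ suc m)) ≈ 0#
  deflate-vanish m a s q root vanish k = x≉0∧x*y≈0⇒y≈0 (ι≉0 k) (begin
    ι (suc k) * (horner (deflate (ι m) s) x * horner q x)
      ≈⟨ *-assoc _ _ _ ⟨
    ι (suc k) * horner (deflate (ι m) s) x * horner q x
      ≈⟨ *-congʳ (*-congˡ (horner-cong (deflate (ι m) s) x≈)) ⟩
    ι (suc k) * horner (deflate (ι m) s) (ι (suc k) + ι m) * horner q x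
      ≈⟨ *-congʳ (horner-root (ι m) (ι (suc k)) a s root) ⟨
    horner (a ∷ s) (ι (suc k) + ι m) * horner q x
      ≈⟨ *-congʳ (horner-cong (a ∷ s) x≈) ⟨
    horner (a ∷ s) x * horner q x
      ≡⟨ ≡.cong (λ l → horner (a ∷ s) (ι l) * horner q (ι l)) (ℕ.+-suc k m) ⟩
    horner (a ∷ s) (ι (suc k ℕ.+ m)) * horner q (ι (suc k ℕ.+ m))
      ≈⟨ vanish (suc k) ⟩
    0# ∎)
    where
    x = ι (k ℕ.+ suc m)
    x≈ : x ≈ ι (suc k) + ι m
    x≈ = trans (reflexive (≡.cong ι (ℕ.+-suc k m))) (ι-+ (suc k) m)

  -- At each of the points ι m, ι (m + 1), … a root is divided out of one of the two factors.
  zero-product : ∀ {i j} m p q → length p ≡ i → length q ≡ j →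
    (∀ k → horner p (ι (k ℕ.+ m)) * horner q (ι (k ℕ.+ m)) ≈ 0#) →
    All (_≈ 0#) p ⊎ All (_≈ 0#) q
  zero-product m []      q  _ _ vanish = inj₁ []
  zero-product m (_ ∷ _) [] _ _ vanish = inj₂ []
  -- The recursion is on the lengths `i` and `j`, since the deflated factor is not a subterm of the
  -- original one.
  zero-product {suc i} {suc j} m (a ∷ s) (b ∷ t) ∣p∣ ∣q∣ vanish with noZeroDivisors (vanish 0)
  ... | inj₁ root = Sum.map₁ (root-deflate-zero (ι m) a s root)
    (zero-product (suc m) (deflate (ι m) s) (b ∷ t)
      (≡.trans (length-deflate (ι m) s) (ℕ.suc-injective ∣p∣)) ∣q∣
      (deflate-vanish m a s (b ∷ t) root vanish))
  ... | inj₂ root = Sum.map₂ (root-deflate-zero (ι m) b t root)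
    (zero-product (suc m) (a ∷ s) (deflate (ι m) t)
      ∣p∣ (≡.trans (length-deflate (ι m) t) (ℕ.suc-injective ∣q∣))
      λ k → trans (*-comm _ _)
        (deflate-vanish m b t (a ∷ s) root (λ k → trans (*-comm _ _) (vanish k)) k))

  -- The case of `zero-product` with second factor the constant 1, which cannot be zero. It lets
  -- identities between polynomials be checked on values.
  horner-zero⁻¹ : ∀ p → (∀ k → horner p (ι k) ≈ 0#) → All (_≈ 0#) p
  horner-zero⁻¹ p vanish with zero-product 0 p (1# ∷ []) ≡.refl ≡.refl
                                (λ k → x≈0⇒x*y≈0 _ (vanish (k ℕ.+ 0)))
  ... | inj₁ p≈0          = p≈0
  ... | inj₂ (1≈0 ∷ [])   = ⊥-elim (1≉0 1≈0)

-- Polynomials in several variables: coefficients and values.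

-- The notions of Defs over an abstract domain. At 𝔽 they agree with Defs definitionally, except
-- for what involves powers.
module Polynomials (D : CharZeroDomain) where
  open CharZeroDomain D
  open UnivariatePolynomials D
  open import Relation.Binary.Reasoning.Setoid setoid
  open import Algebra.Solver.Ring.NaturalCoefficients.Default commutativeSemiring
    using (solve; con; _:=_; _:+_; _:*_)

  pow : Carrier → ℕ → Carrier
  pow x zero    = 1#
  pow x (suc k) = x * pow x k

  sign : ℕ → Carrier
  sign k = pow (- 1#) k

  Poly : ℕ → Set
  Poly n = List (Vec ℕ n × Carrier)

  coeff : ∀ {n} → Poly n → Vec ℕ n → Carrier
  coeff p μ = foldr (λ t acc → if does (≡-dec ℕ._≟_ (proj₁ t) μ) then proj₂ t + acc else acc) 0# p

  infix 4 _≈P_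
  _≈P_ : ∀ {n} → Poly n → Poly n → Set
  p ≈P q = ∀ μ → coeff p μ ≈ coeff q μ

  -- scaling (constant weight) and x ↦ -x (weight sign ∘ degree) are both of this form
  reweight : ∀ {n} → (Vec ℕ n → Carrier) → Poly n → Poly n
  reweight s = map (λ t → proj₁ t , s (proj₁ t) * proj₂ t)

  scaleP : ∀ {n} → Carrier → Poly n → Poly n
  scaleP c = reweight (λ _ → c)

  negArg : ∀ {n} → Poly n → Poly n
  negArg = reweight (λ μ → sign (Vec.sum μ))

  infixl 6 _-P_
  _-P_ : ∀ {n} → Poly n → Poly n → Poly n
  p -P q = p ++ scaleP (- 1#) q

  evalMon : ∀ {n} → Vec Carrier n → Vec ℕ n → Carrier
  evalMon x μ = Vec.foldr _ _*_ 1# (Vec.zipWith pow x μ)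

  eval : ∀ {n} → Poly n → Vec Carrier n → Carrier
  eval p x = foldr (λ t acc → proj₂ t * evalMon x (proj₁ t) + acc) 0# p

  topComp : ∀ {n} → ℕ → Poly n → Poly n
  topComp k = filter (λ t → Vec.sum (proj₁ t) ℕ.≟ k)

  IsHomog DegLt DegLe : ∀ {n} → ℕ → Poly n → Set
  IsHomog d p = ∀ μ → Vec.sum μ ≢ d → coeff p μ ≈ 0#
  DegLt d p = ∀ μ → d ≤ Vec.sum μ → coeff p μ ≈ 0#
  DegLe d p = ∀ μ → d < Vec.sum μ → coeff p μ ≈ 0#

  coeff-++ : ∀ {n} (p q : Poly n) μ → coeff (p ++ q) μ ≈ coeff p μ + coeff q μ
  coeff-++ []            q μ = sym (+-identityˡ _)
  coeff-++ ((ν , c) ∷ p) q μ with does (≡-dec ℕ._≟_ ν μ)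
  ... | true  = trans (+-congˡ (coeff-++ p q μ)) (sym (+-assoc _ _ _))
  ... | false = coeff-++ p q μ

  coeff-reweight : ∀ {n} s (p : Poly n) μ → coeff (reweight s p) μ ≈ s μ * coeff p μ
  coeff-reweight s []            μ = sym (zeroʳ _)
  coeff-reweight s ((ν , c) ∷ p) μ with ≡-dec ℕ._≟_ ν μ
  ... | yes ≡.refl = trans (+-congˡ (coeff-reweight s p μ)) (sym (distribˡ _ _ _))
  ... | no  _      = coeff-reweight s p μ

  coeff-minus : ∀ {n} (p q : Poly n) μ → coeff (p -P q) μ ≈ coeff p μ + (- 1#) * coeff q μ
  coeff-minus p q μ = trans (coeff-++ p _ μ) (+-congˡ (coeff-reweight _ q μ))

  module _ {n} {Q : Pred (Vec ℕ n) 0ℓ} (Q? : Decidable Q) where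

    coeff-filter : ∀ p {μ} → Q μ → coeff (filter (λ t → Q? (proj₁ t)) p) μ ≈ coeff p μ
    coeff-filter []            qμ = refl
    coeff-filter ((ν , c) ∷ p) {μ} qμ with Q? ν
    coeff-filter ((ν , c) ∷ p) {μ} qμ | yes _ with does (≡-dec ℕ._≟_ ν μ)
    ... | true  = +-congˡ (coeff-filter p qμ)
    ... | false = coeff-filter p qμ
    coeff-filter ((ν , c) ∷ p) {μ} qμ | no ¬qν with ≡-dec ℕ._≟_ ν μ
    ... | yes ≡.refl = ⊥-elim (¬qν qμ)
    ... | no  _      = coeff-filter p qμ

    coeff-filter-no : ∀ p {μ} → ¬ Q μ → coeff (filter (λ t → Q? (proj₁ t)) p) μ ≈ 0#
    coeff-filter-no []            ¬qμ = refl
    coeff-filter-no ((ν , c) ∷ p) {μ} ¬qμ with Q? ν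
    ... | no _ = coeff-filter-no p ¬qμ
    ... | yes qν with ≡-dec ℕ._≟_ ν μ
    ...   | yes ≡.refl = ⊥-elim (¬qμ qν)
    ...   | no  _      = coeff-filter-no p ¬qμ

  eval-++ : ∀ {n} (p q : Poly n) x → eval (p ++ q) x ≈ eval p x + eval q x
  eval-++ []      q x = sym (+-identityˡ _)
  eval-++ (t ∷ p) q x = trans (+-congˡ (eval-++ p q x)) (sym (+-assoc _ _ _))

  eval-scale : ∀ {n} c (p : Poly n) x → eval (scaleP c p) x ≈ c * eval p x
  eval-scale c []      x = sym (zeroʳ c)
  eval-scale c (t ∷ p) x = trans (+-cong (*-assoc _ _ _) (eval-scale c p x)) (sym (distribˡ _ _ _))

  eval-minus : ∀ {n} (p q : Poly n) x → eval (p -P q) x ≈ eval p x + (- 1#) * eval q x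
  eval-minus p q x = trans (eval-++ p _ x) (+-congˡ (eval-scale _ q x))

  evalMon-cong : ∀ {n} (x y : Vec Carrier n) → (∀ i → Vec.lookup x i ≈ Vec.lookup y i) →
    ∀ μ → evalMon x μ ≈ evalMon y μ
  evalMon-cong []      []      x≈y []      = refl
  evalMon-cong (a ∷ x) (b ∷ y) x≈y (k ∷ μ) =
    *-cong (pow-cong k) (evalMon-cong x y (λ i → x≈y (suc i)) μ)
    where
    pow-cong : ∀ k → pow a k ≈ pow b k
    pow-cong zero    = refl
    pow-cong (suc k) = *-cong (x≈y zero) (pow-cong k)

  eval-cong-arg : ∀ {n} (p : Poly n) x y → (∀ i → Vec.lookup x i ≈ Vec.lookup y i) →
    eval p x ≈ eval p y
  eval-cong-arg []      x y x≈y = refl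
  eval-cong-arg (t ∷ p) x y x≈y =
    +-cong (*-congˡ (evalMon-cong x y x≈y (proj₁ t))) (eval-cong-arg p x y x≈y)

  pow-neg : ∀ x k → pow (- x) k ≈ sign k * pow x k
  pow-neg x zero    = sym (*-identityˡ _)
  pow-neg x (suc k) = begin
    (- x) * pow (- x) k               ≈⟨ *-cong (sym (-1*x≈-x x)) (pow-neg x k) ⟩
    (- 1# * x) * (sign k * pow x k)
      ≈⟨ solve 4 (λ e x s p → (e :* x) :* (s :* p) := (e :* s) :* (x :* p)) refl _ _ _ _ ⟩
    (- 1# * sign k) * (x * pow x k)   ∎
    where open import Algebra.Properties.Ring ring using (-1*x≈-x)

  pow-+ : ∀ x j k → pow x (j ℕ.+ k) ≈ pow x j * pow x k
  pow-+ x zero    k = sym (*-identityˡ _)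
  pow-+ x (suc j) k = trans (*-congˡ (pow-+ x j k)) (sym (*-assoc _ _ _))

  evalMon-neg : ∀ {n} (x : Vec Carrier n) μ →
    evalMon (Vec.map -_ x) μ ≈ sign (Vec.sum μ) * evalMon x μ
  evalMon-neg []      []      = sym (*-identityˡ _)
  evalMon-neg (a ∷ x) (k ∷ μ) = begin
    pow (- a) k * evalMon (Vec.map -_ x) μ
      ≈⟨ *-cong (pow-neg a k) (evalMon-neg x μ) ⟩
    (sign k * pow a k) * (sign (Vec.sum μ) * evalMon x μ)
      ≈⟨ solve 4 (λ s p t m → (s :* p) :* (t :* m) := (s :* t) :* (p :* m)) refl _ _ _ _ ⟩
    (sign k * sign (Vec.sum μ)) * (pow a k * evalMon x μ)
      ≈⟨ *-congʳ (pow-+ (- 1#) k (Vec.sum μ)) ⟨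
    sign (k ℕ.+ Vec.sum μ) * (pow a k * evalMon x μ) ∎

  eval-negArg : ∀ {n} (p : Poly n) x → eval (negArg p) x ≈ eval p (Vec.map -_ x)
  eval-negArg []            x = refl
  eval-negArg ((μ , c) ∷ p) x = +-cong
    (trans (solve 3 (λ s c m → (s :* c) :* m := c :* (s :* m)) refl _ _ _)
      (*-congˡ (sym (evalMon-neg x μ))))
    (eval-negArg p x)

  -- p = const₀ p + x₁ · shift₀ p, the part without x₁ and the part divisible by x₁
  const₀ : ∀ {n} → Poly (suc n) → Poly n
  const₀ []                      = []
  const₀ ((zero  ∷ μ , c) ∷ p) = (μ , c) ∷ const₀ p
  const₀ ((suc k ∷ μ , c) ∷ p) = const₀ p

  shift₀ : ∀ {n} → Poly (suc n) → Poly (suc n)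
  shift₀ []                      = []
  shift₀ ((zero  ∷ μ , c) ∷ p) = shift₀ p
  shift₀ ((suc k ∷ μ , c) ∷ p) = (k ∷ μ , c) ∷ shift₀ p

  coeff-const₀ : ∀ {n} (p : Poly (suc n)) μ → coeff (const₀ p) μ ≡ coeff p (zero ∷ μ)
  coeff-const₀ []                    μ = ≡.refl
  coeff-const₀ ((zero  ∷ ν , c) ∷ p) μ rewrite coeff-const₀ p μ = ≡.refl
  coeff-const₀ ((suc k ∷ ν , c) ∷ p) μ = coeff-const₀ p μ

  coeff-shift₀ : ∀ {n} (p : Poly (suc n)) k μ → coeff (shift₀ p) (k ∷ μ) ≡ coeff p (suc k ∷ μ)
  coeff-shift₀ []                    k μ = ≡.refl
  coeff-shift₀ ((zero  ∷ ν , c) ∷ p) k μ = coeff-shift₀ p k μ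
  coeff-shift₀ ((suc j ∷ ν , c) ∷ p) k μ rewrite coeff-shift₀ p k μ = ≡.refl

  eval-split : ∀ {n} (p : Poly (suc n)) x xs →
    eval p (x ∷ xs) ≈ eval (const₀ p) xs + x * eval (shift₀ p) (x ∷ xs)
  eval-split []                    x xs = solve 1 (λ x → con 0 := con 0 :+ x :* con 0) refl x
  eval-split ((zero  ∷ μ , c) ∷ p) x xs = begin
    c * (1# * evalMon xs μ) + eval p (x ∷ xs)
      ≈⟨ +-cong (*-congˡ (*-identityˡ _)) (eval-split p x xs) ⟩
    c * evalMon xs μ + (eval (const₀ p) xs + x * eval (shift₀ p) (x ∷ xs))
      ≈⟨ +-assoc _ _ _ ⟨
    c * evalMon xs μ + eval (const₀ p) xs + x * eval (shift₀ p) (x ∷ xs) ∎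
  eval-split ((suc k ∷ μ , c) ∷ p) x xs = begin
    c * (x * pow x k * evalMon xs μ) + eval p (x ∷ xs)
      ≈⟨ +-congˡ (eval-split p x xs) ⟩
    c * (x * pow x k * evalMon xs μ) + (eval (const₀ p) xs + x * eval (shift₀ p) (x ∷ xs))
      ≈⟨ solve 6 (λ c x y m a b → c :* (x :* y :* m) :+ (a :+ x :* b) := a :+ x :* (c :* (y :* m) :+ b))
           refl _ _ _ _ _ _ ⟩
    eval (const₀ p) xs + x * (c * (pow x k * evalMon xs μ) + eval (shift₀ p) (x ∷ xs)) ∎

  -- Bounds the exponents of the first variable in all listed terms, cancelling ones included. Each
  -- `shift₀` lowers the bound, so it measures how often the splitting can be repeated.
  Deg₀< : ∀ {n} → ℕ → Poly (suc n) → Set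
  Deg₀< N = All (λ t → Vec.head (proj₁ t) < N)

  deg₀-bound : ∀ {n} (p : Poly (suc n)) → ∃ λ N → Deg₀< N p
  deg₀-bound []                = 0 , []
  deg₀-bound ((k ∷ μ , c) ∷ p) with deg₀-bound p
  ... | N , p<N = suc k ℕ.+ N , ℕ.m≤m+n (suc k) N ∷ All.map (λ k<N → ℕ.≤-trans k<N (ℕ.m≤n+m N (suc k))) p<N

  deg₀-shift₀ : ∀ {n N} (p : Poly (suc n)) → Deg₀< (suc N) p → Deg₀< N (shift₀ p)
  deg₀-shift₀ []                    []             = []
  deg₀-shift₀ ((zero  ∷ μ , c) ∷ p) (_ ∷ p<)       = deg₀-shift₀ p p<
  deg₀-shift₀ ((suc k ∷ μ , c) ∷ p) (s≤s k< ∷ p<) = k< ∷ deg₀-shift₀ p p<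

  eval-[] : (p : Poly 0) → eval p [] ≈ coeff p []
  eval-[] []             = refl
  eval-[] (([] , c) ∷ p) = +-cong (*-identityʳ c) (eval-[] p)

  -- Vanishing coefficients say nothing about single terms, which may cancel each other. Splitting
  -- off the first variable collects them: induction on the number of variables handles `const₀`,
  -- induction on the exponent bound handles `shift₀`.
  ≈P0⇒eval≈0 : ∀ {n} (p : Poly n) → (∀ μ → coeff p μ ≈ 0#) → ∀ x → eval p x ≈ 0#
  ≈P0⇒eval≈0 {zero}  p p≈0 []       = trans (eval-[] p) (p≈0 [])
  ≈P0⇒eval≈0 {suc n} p p≈0 (x ∷ xs) = go (proj₁ (deg₀-bound p)) p (proj₂ (deg₀-bound p)) p≈0
    where
    go : ∀ N p → Deg₀< N p → (∀ μ → coeff p μ ≈ 0#) → eval p (x ∷ xs) ≈ 0#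
    go zero    []      []       p≈0 = refl
    go zero    (_ ∷ _) (() ∷ _) p≈0
    go (suc N) p       p<       p≈0 = trans (eval-split p x xs) (0+0≈0
      (≈P0⇒eval≈0 (const₀ p) (λ μ → trans (reflexive (coeff-const₀ p μ)) (p≈0 _)) xs)
      (y≈0⇒x*y≈0 x (go N (shift₀ p) (deg₀-shift₀ p p<)
        λ { (k ∷ μ) → trans (reflexive (coeff-shift₀ p k μ)) (p≈0 _) })))

  eval-cong : ∀ {n} (p q : Poly n) → p ≈P q → ∀ x → eval p x ≈ eval q x
  eval-cong p q p≈q x = x-y≈0⇒x≈y (trans (sym (eval-minus p q x))
    (≈P0⇒eval≈0 (p -P q) (λ μ → trans (coeff-minus p q μ) (x≈y⇒x-y≈0 (p≈q μ))) x))

  -- `p` as a univariate polynomial in the first variable, with the other variables specialised to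
  -- `xs`.
  coefficients₀ : ∀ {n} → ℕ → Poly (suc n) → Vec Carrier n → List Carrier
  coefficients₀ zero    p xs = []
  coefficients₀ (suc N) p xs = eval (const₀ p) xs ∷ coefficients₀ N (shift₀ p) xs

  horner-coefficients₀ : ∀ {n} N (p : Poly (suc n)) → Deg₀< N p → ∀ x xs →
    horner (coefficients₀ N p xs) x ≈ eval p (x ∷ xs)
  horner-coefficients₀ zero    []      []       x xs = refl
  horner-coefficients₀ zero    (_ ∷ _) (() ∷ _) x xs
  horner-coefficients₀ (suc N) p       p<       x xs = trans
    (+-congˡ (*-congˡ (horner-coefficients₀ N (shift₀ p) (deg₀-shift₀ p p<) x xs)))
    (sym (eval-split p x xs))

  -- For fixed `xs` the polynomial in the first variable vanishes at every natural number, so all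
  -- its coefficients vanish at `xs`; these are polynomials in the other variables, to which
  -- induction applies.
  eval≈0⇒≈P0 : ∀ {n} (p : Poly n) → (∀ x → eval p x ≈ 0#) → ∀ μ → coeff p μ ≈ 0#
  eval≈0⇒≈P0 {zero}  p vanish []      = trans (sym (eval-[] p)) (vanish [])
  eval≈0⇒≈P0 {suc n} p vanish (k ∷ μ) = go (proj₁ (deg₀-bound p)) p
    (λ xs → horner-zero⁻¹ _ λ k → trans
      (horner-coefficients₀ _ p (proj₂ (deg₀-bound p)) (ι k) xs) (vanish (ι k ∷ xs)))
    (proj₂ (deg₀-bound p)) k
    where
    go : ∀ N p → (∀ xs → All (_≈ 0#) (coefficients₀ N p xs)) → Deg₀< N p →
      ∀ k → coeff p (k ∷ μ) ≈ 0#
    go zero    []      cs≈0 []       k       = refl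
    go zero    (_ ∷ _) cs≈0 (() ∷ _) k
    go (suc N) p       cs≈0 p<       zero    = trans (reflexive (≡.sym (coeff-const₀ p μ)))
      (eval≈0⇒≈P0 (const₀ p) (λ xs → All.head (cs≈0 xs)) μ)
    go (suc N) p       cs≈0 p<       (suc k) = trans (reflexive (≡.sym (coeff-shift₀ p k μ)))
      (go N (shift₀ p) (λ xs → All.tail (cs≈0 xs)) (deg₀-shift₀ p p<) k)

-- Ranks in a composition when an entry is appended.

lookup-∷ʳ-inject₁ : ∀ {A : Set} {n} (xs : Vec A n) x i →
  Vec.lookup (xs ∷ʳ x) (inject₁ i) ≡ Vec.lookup xs i
lookup-∷ʳ-inject₁ (y ∷ xs) x zero    = ≡.refl
lookup-∷ʳ-inject₁ (y ∷ xs) x (suc i) = lookup-∷ʳ-inject₁ xs x i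

lookup-∷ʳ-fromℕ : ∀ {A : Set} {n} (xs : Vec A n) x → Vec.lookup (xs ∷ʳ x) (fromℕ n) ≡ x
lookup-∷ʳ-fromℕ []       x = ≡.refl
lookup-∷ʳ-fromℕ (y ∷ xs) x = lookup-∷ʳ-fromℕ xs x

sum-∷ʳ : ∀ {n} (μ : Vec ℕ n) k → Vec.sum (μ ∷ʳ k) ≡ k ℕ.+ Vec.sum μ
sum-∷ʳ []      k = ≡.refl
sum-∷ʳ (j ∷ μ) k = begin
  j ℕ.+ Vec.sum (μ ∷ʳ k)    ≡⟨ ≡.cong (j ℕ.+_) (sum-∷ʳ μ k) ⟩
  j ℕ.+ (k ℕ.+ Vec.sum μ)   ≡⟨ ℕ.+-assoc j k _ ⟨
  j ℕ.+ k ℕ.+ Vec.sum μ     ≡⟨ ≡.cong (ℕ._+ Vec.sum μ) (ℕ.+-comm j k) ⟩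
  k ℕ.+ j ℕ.+ Vec.sum μ     ≡⟨ ℕ.+-assoc k j _ ⟩
  k ℕ.+ (j ℕ.+ Vec.sum μ)   ∎
  where open ≡.≡-Reasoning

indicator : Bool → ℕ
indicator true  = 1
indicator false = 0

-- With `y <ᵇ suc x` in place of `y ≤ᵇ x`, the weak comparison with a first entry `x` is literally
-- the strict comparison with a last entry `suc x`.
count≤ : ∀ {n} → ℕ → Vec ℕ n → ℕ
count≤ x []      = 0
count≤ x (y ∷ γ) = indicator (y ℕ.<ᵇ suc x) ℕ.+ count≤ x γ

-- δ-entry n - 1 - w_γ⁻¹(i): the number of positions sorted after i, namely those k
-- with γ_k < γ_i, or γ_k = γ_i and k > i
below : ∀ {n} → Vec ℕ n → Fin n → ℕ
below (x ∷ γ) zero    = count≤ x γ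
below (x ∷ γ) (suc i) = indicator (x ℕ.<ᵇ Vec.lookup γ i) ℕ.+ below γ i

count≤-∷ʳ : ∀ {n} x (γ : Vec ℕ n) y →
  count≤ x (γ ∷ʳ y) ≡ indicator (y ℕ.<ᵇ suc x) ℕ.+ count≤ x γ
count≤-∷ʳ x []      y = ≡.refl
count≤-∷ʳ x (z ∷ γ) y rewrite count≤-∷ʳ x γ y =
  x∙yz≈y∙xz ℕ.+-commutativeSemigroup (indicator (z ℕ.<ᵇ suc x)) (indicator (y ℕ.<ᵇ suc x)) (count≤ x γ)

-- Applied to two kinds of `y`. For `y = 0` the indicator computes to 1, so every earlier rank rises
-- by one; for `y = suc x` it computes to the contribution of a first entry `x`, so ranks survive
-- the rotation.
below-∷ʳ-inject₁ : ∀ {n} (γ : Vec ℕ n) y i →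
  below (γ ∷ʳ y) (inject₁ i) ≡ indicator (y ℕ.<ᵇ suc (Vec.lookup γ i)) ℕ.+ below γ i
below-∷ʳ-inject₁ (x ∷ γ) y zero    = count≤-∷ʳ x γ y
below-∷ʳ-inject₁ (x ∷ γ) y (suc i) rewrite lookup-∷ʳ-inject₁ γ y i | below-∷ʳ-inject₁ γ y i =
  x∙yz≈y∙xz ℕ.+-commutativeSemigroup (indicator (x ℕ.<ᵇ Vec.lookup γ i)) (indicator (y ℕ.<ᵇ suc (Vec.lookup γ i))) (below γ i)

below-∷ʳ-fromℕ-zero : ∀ {n} (γ : Vec ℕ n) → below (γ ∷ʳ 0) (fromℕ n) ≡ 0
below-∷ʳ-fromℕ-zero []      = ≡.refl
below-∷ʳ-fromℕ-zero (x ∷ γ) rewrite lookup-∷ʳ-fromℕ γ 0 = below-∷ʳ-fromℕ-zero γ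

-- A first entry `x` has the entries equal to it sorted after it; as a last entry it would lose
-- these ties, and raising it to `suc x` compensates exactly. Its rank is thus unchanged by the
-- rotation.
below-∷ʳ-fromℕ-suc : ∀ {n} (γ : Vec ℕ n) x → below (γ ∷ʳ suc x) (fromℕ n) ≡ count≤ x γ
below-∷ʳ-fromℕ-suc []      x = ≡.refl
below-∷ʳ-fromℕ-suc (y ∷ γ) x rewrite lookup-∷ʳ-fromℕ γ (suc x) =
  ≡.cong (indicator (y ℕ.<ᵇ suc x) ℕ.+_) (below-∷ʳ-fromℕ-suc γ x)

-- Polynomial expressions with a degree bound: substitution and division.

module PolynomialExpressions (D : CharZeroDomain) where
  open CharZeroDomain D
  open Polynomials D
  open import Relation.Binary.Reasoning.Setoid setoid
  open import Algebra.Solver.Ring.NaturalCoefficients.Default commutativeSemiring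
    using (solve; con; _:=_; _:+_; _:*_)

  infixr 5 var_⊠_
  infixl 4 _⊞_
  -- The second index bounds the degree. Substitution and division then respect degrees by typing,
  -- and the bound serves as induction variable.
  data Expr (n : ℕ) : ℕ → Set where
    const  : ∀ {d} → Carrier → Expr n d
    _⊞_    : ∀ {d} → Expr n d → Expr n d → Expr n d
    var_⊠_ : ∀ {d} → Fin n → Expr n d → Expr n (suc d)

  ⟦_⟧ : ∀ {n d} → Expr n d → Vec Carrier n → Carrier
  ⟦ const c ⟧   x = c
  ⟦ e ⊞ e′ ⟧    x = ⟦ e ⟧ x + ⟦ e′ ⟧ x
  ⟦ var i ⊠ e ⟧ x = Vec.lookup x i * ⟦ e ⟧ x

  ⟦⟧-cong : ∀ {n d} (e : Expr n d) {x y} → (∀ i → Vec.lookup x i ≈ Vec.lookup y i) →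
    ⟦ e ⟧ x ≈ ⟦ e ⟧ y
  ⟦⟧-cong (const c)   x≈y = refl
  ⟦⟧-cong (e ⊞ e′)    x≈y = +-cong (⟦⟧-cong e x≈y) (⟦⟧-cong e′ x≈y)
  ⟦⟧-cong (var i ⊠ e) x≈y = *-cong (x≈y i) (⟦⟧-cong e x≈y)

  ⟦⟧-degree-zero : ∀ {n} (e : Expr n 0) x y → ⟦ e ⟧ x ≈ ⟦ e ⟧ y
  ⟦⟧-degree-zero (const c) x y = refl
  ⟦⟧-degree-zero (e ⊞ e′)  x y = +-cong (⟦⟧-degree-zero e x y) (⟦⟧-degree-zero e′ x y)

  raise : ∀ {n d d′} → d ≤ d′ → Expr n d → Expr n d′
  raise d≤d′       (const c)   = const c
  raise d≤d′       (e ⊞ e′)    = raise d≤d′ e ⊞ raise d≤d′ e′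
  raise (s≤s d≤d′) (var i ⊠ e) = var i ⊠ raise d≤d′ e

  ⟦raise⟧ : ∀ {n d d′} (d≤d′ : d ≤ d′) (e : Expr n d) x → ⟦ raise d≤d′ e ⟧ x ≈ ⟦ e ⟧ x
  ⟦raise⟧ d≤d′       (const c)   x = refl
  ⟦raise⟧ d≤d′       (e ⊞ e′)    x = +-cong (⟦raise⟧ d≤d′ e x) (⟦raise⟧ d≤d′ e′ x)
  ⟦raise⟧ (s≤s d≤d′) (var i ⊠ e) x = *-congˡ (⟦raise⟧ d≤d′ e x)

  infixr 5 _•_
  _•_ : ∀ {n d} → Carrier → Expr n d → Expr n d
  c • const a     = const (c * a)
  c • (e ⊞ e′)    = c • e ⊞ c • e′
  c • (var i ⊠ e) = var i ⊠ (c • e)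

  ⟦•⟧ : ∀ {n d} c (e : Expr n d) x → ⟦ c • e ⟧ x ≈ c * ⟦ e ⟧ x
  ⟦•⟧ c (const a)   x = refl
  ⟦•⟧ c (e ⊞ e′)    x = trans (+-cong (⟦•⟧ c e x) (⟦•⟧ c e′ x)) (sym (distribˡ _ _ _))
  ⟦•⟧ c (var i ⊠ e) x = trans (*-congˡ (⟦•⟧ c e x))
    (solve 3 (λ x c e → x :* (c :* e) := c :* (x :* e)) refl _ _ _)

  weaken : ∀ {n d} → Expr n d → Expr (suc n) d
  weaken (const c)   = const c
  weaken (e ⊞ e′)    = weaken e ⊞ weaken e′
  weaken (var i ⊠ e) = var suc i ⊠ weaken e

  ⟦weaken⟧ : ∀ {n d} (e : Expr n d) x xs → ⟦ weaken e ⟧ (x ∷ xs) ≈ ⟦ e ⟧ xs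
  ⟦weaken⟧ (const c)   x xs = refl
  ⟦weaken⟧ (e ⊞ e′)    x xs = +-cong (⟦weaken⟧ e x xs) (⟦weaken⟧ e′ x xs)
  ⟦weaken⟧ (var i ⊠ e) x xs = *-congˡ (⟦weaken⟧ e x xs)

  x₁^_⊠_ : ∀ {n d} k → Expr (suc n) d → Expr (suc n) (k ℕ.+ d)
  x₁^ zero  ⊠ e = e
  x₁^ suc k ⊠ e = var zero ⊠ (x₁^ k ⊠ e)

  ⟦x₁^⟧ : ∀ {n d} k (e : Expr (suc n) d) x xs →
    ⟦ x₁^ k ⊠ e ⟧ (x ∷ xs) ≈ pow x k * ⟦ e ⟧ (x ∷ xs)
  ⟦x₁^⟧ zero    e x xs = sym (*-identityˡ _)
  ⟦x₁^⟧ (suc k) e x xs = trans (*-congˡ (⟦x₁^⟧ k e x xs)) (sym (*-assoc _ _ _))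

  monomial : ∀ {n} (μ : Vec ℕ n) → Expr n (Vec.sum μ)
  monomial []      = const 1#
  monomial (k ∷ μ) = x₁^ k ⊠ weaken (monomial μ)

  ⟦monomial⟧ : ∀ {n} (μ : Vec ℕ n) x → ⟦ monomial μ ⟧ x ≈ evalMon x μ
  ⟦monomial⟧ []      []       = refl
  ⟦monomial⟧ (k ∷ μ) (x ∷ xs) = trans (⟦x₁^⟧ k (weaken (monomial μ)) x xs)
    (*-congˡ (trans (⟦weaken⟧ (monomial μ) x xs) (⟦monomial⟧ μ xs)))

  toExpr : ∀ {n d} (p : Poly n) → All (λ t → Vec.sum (proj₁ t) ≤ d) p → Expr n d
  toExpr []            []         = const 0#
  toExpr ((μ , c) ∷ p) (μ≤ ∷ p≤) = c • raise μ≤ (monomial μ) ⊞ toExpr p p≤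

  ⟦toExpr⟧ : ∀ {n d} (p : Poly n) (p≤ : All (λ t → Vec.sum (proj₁ t) ≤ d) p) x →
    ⟦ toExpr p p≤ ⟧ x ≈ eval p x
  ⟦toExpr⟧ []            []         x = refl
  ⟦toExpr⟧ ((μ , c) ∷ p) (μ≤ ∷ p≤) x = +-cong
    (trans (⟦•⟧ c (raise μ≤ (monomial μ)) x)
      (*-congˡ (trans (⟦raise⟧ μ≤ (monomial μ) x) (⟦monomial⟧ μ x))))
    (⟦toExpr⟧ p p≤ x)

  fixLast : ∀ {n d} → Carrier → Expr (suc n) d → Expr n d
  fixLast c (const a)   = const a
  fixLast c (e ⊞ e′)    = fixLast c e ⊞ fixLast c e′
  fixLast c (var i ⊠ e) with view i
  ... | ‵fromℕ     = raise (ℕ.n≤1+n _) (c • fixLast c e)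
  ... | ‵inject₁ j = var j ⊠ fixLast c e

  ⟦fixLast⟧ : ∀ {n d} c (e : Expr (suc n) d) xs → ⟦ fixLast c e ⟧ xs ≈ ⟦ e ⟧ (xs ∷ʳ c)
  ⟦fixLast⟧ c (const a)   xs = refl
  ⟦fixLast⟧ c (e ⊞ e′)    xs = +-cong (⟦fixLast⟧ c e xs) (⟦fixLast⟧ c e′ xs)
  ⟦fixLast⟧ c (var i ⊠ e) xs with view i
  ... | ‵fromℕ     = trans (⟦raise⟧ (ℕ.n≤1+n _) (c • fixLast c e) xs)
    (trans (⟦•⟧ c (fixLast c e) xs)
      (*-cong (reflexive (≡.sym (lookup-∷ʳ-fromℕ xs c))) (⟦fixLast⟧ c e xs)))
  ... | ‵inject₁ j = *-cong (reflexive (≡.sym (lookup-∷ʳ-inject₁ xs c j))) (⟦fixLast⟧ c e xs)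

  -- the substitution xₙ ↦ x₁ + 1, xᵢ ↦ xᵢ₊₁
  rotate : ∀ {n d} → Expr (suc n) d → Expr (suc n) d
  rotate (const c)   = const c
  rotate (e ⊞ e′)    = rotate e ⊞ rotate e′
  rotate (var i ⊠ e) with view i
  ... | ‵fromℕ     = raise (ℕ.n≤1+n _) (rotate e) ⊞ var zero ⊠ rotate e
  ... | ‵inject₁ j = var suc j ⊠ rotate e

  ⟦rotate⟧ : ∀ {n d} (e : Expr (suc n) d) x xs →
    ⟦ rotate e ⟧ (x ∷ xs) ≈ ⟦ e ⟧ (xs ∷ʳ (1# + x))
  ⟦rotate⟧ (const c)   x xs = refl
  ⟦rotate⟧ (e ⊞ e′)    x xs = +-cong (⟦rotate⟧ e x xs) (⟦rotate⟧ e′ x xs)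
  ⟦rotate⟧ (var i ⊠ e) x xs with view i
  ... | ‵fromℕ     = begin
    ⟦ raise (ℕ.n≤1+n _) (rotate e) ⟧ (x ∷ xs) + x * ⟦ rotate e ⟧ (x ∷ xs)
      ≈⟨ +-congʳ (⟦raise⟧ (ℕ.n≤1+n _) (rotate e) (x ∷ xs)) ⟩
    ⟦ rotate e ⟧ (x ∷ xs) + x * ⟦ rotate e ⟧ (x ∷ xs)
      ≈⟨ trans (distribʳ _ 1# x) (+-congʳ (*-identityˡ _)) ⟨
    (1# + x) * ⟦ rotate e ⟧ (x ∷ xs)
      ≈⟨ *-cong (reflexive (≡.sym (lookup-∷ʳ-fromℕ xs (1# + x)))) (⟦rotate⟧ e x xs) ⟩
    Vec.lookup (xs ∷ʳ (1# + x)) (fromℕ _) * ⟦ e ⟧ (xs ∷ʳ (1# + x)) ∎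
  ... | ‵inject₁ j = *-cong (reflexive (≡.sym (lookup-∷ʳ-inject₁ xs (1# + x) j))) (⟦rotate⟧ e x xs)

  -- Divides `e - e(c)` by `xₙ - c`, where `e(c)` has `c` in place of `xₙ`. The rule for a factor
  -- `xₙ` comes from `xₙ e - c e(c) = (xₙ - c) e + c (e - e(c))`. When `e` has degree zero the last
  -- term is zero, hence the separate clauses for that degree.
  quotient : ∀ {n d} → Carrier → Expr (suc n) (suc d) → Expr (suc n) d
  quotient c (const a)   = const 0#
  quotient c (e ⊞ e′)    = quotient c e ⊞ quotient c e′
  quotient {d = zero} c (var i ⊠ e) with view i
  ... | ‵fromℕ     = e
  ... | ‵inject₁ j = const 0#
  quotient {d = suc d} c (var i ⊠ e) with view i
  ... | ‵fromℕ     = e ⊞ raise (ℕ.n≤1+n _) (c • quotient c e)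
  ... | ‵inject₁ j = var inject₁ j ⊠ quotient c e

  -- Here u stands for xₙ - c.
  ⟦quotient⟧ : ∀ {n d} c (e : Expr (suc n) (suc d)) xs u →
    ⟦ e ⟧ (xs ∷ʳ (u + c)) ≈ u * ⟦ quotient c e ⟧ (xs ∷ʳ (u + c)) + ⟦ e ⟧ (xs ∷ʳ c)
  ⟦quotient⟧ c (const a) xs u = solve 2 (λ u a → a := u :* con 0 :+ a) refl u a
  ⟦quotient⟧ c (e ⊞ e′)  xs u = trans (+-cong (⟦quotient⟧ c e xs u) (⟦quotient⟧ c e′ xs u))
    (solve 5 (λ u q e q′ e′ → (u :* q :+ e) :+ (u :* q′ :+ e′) := u :* (q :+ q′) :+ (e :+ e′))
      refl _ _ _ _ _)
  ⟦quotient⟧ {d = zero} c (var i ⊠ e) xs u with view i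
  ... | ‵fromℕ rewrite lookup-∷ʳ-fromℕ xs (u + c) | lookup-∷ʳ-fromℕ xs c = begin
    (u + c) * ⟦ e ⟧ (xs ∷ʳ (u + c))
      ≈⟨ distribʳ _ _ _ ⟩
    u * ⟦ e ⟧ (xs ∷ʳ (u + c)) + c * ⟦ e ⟧ (xs ∷ʳ (u + c))
      ≈⟨ +-congˡ (*-congˡ (⟦⟧-degree-zero e _ _)) ⟩
    u * ⟦ e ⟧ (xs ∷ʳ (u + c)) + c * ⟦ e ⟧ (xs ∷ʳ c) ∎
  ... | ‵inject₁ j rewrite lookup-∷ʳ-inject₁ xs (u + c) j | lookup-∷ʳ-inject₁ xs c j =
    trans (*-congˡ (⟦⟧-degree-zero e _ _)) (sym (x≈0⇒x+y≈y _ (zeroʳ u)))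
  ⟦quotient⟧ {d = suc d} c (var i ⊠ e) xs u with view i
  ... | ‵fromℕ rewrite lookup-∷ʳ-fromℕ xs (u + c) | lookup-∷ʳ-fromℕ xs c = begin
    (u + c) * E
      ≈⟨ distribʳ _ _ _ ⟩
    u * E + c * E
      ≈⟨ +-congˡ (*-congˡ (⟦quotient⟧ c e xs u)) ⟩
    u * E + c * (u * Q + E₀)
      ≈⟨ solve 5 (λ u c E Q E₀ → u :* E :+ c :* (u :* Q :+ E₀) := u :* (E :+ c :* Q) :+ c :* E₀)
           refl _ _ _ _ _ ⟩
    u * (E + c * Q) + c * E₀
      ≈⟨ +-congʳ (*-congˡ (+-congˡ (trans (⟦raise⟧ (ℕ.n≤1+n _) (c • quotient c e) _) (⟦•⟧ c (quotient c e) _)))) ⟨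
    u * (E + ⟦ raise (ℕ.n≤1+n _) (c • quotient c e) ⟧ (xs ∷ʳ (u + c))) + c * E₀ ∎
    where
    E  = ⟦ e ⟧ (xs ∷ʳ (u + c))
    E₀ = ⟦ e ⟧ (xs ∷ʳ c)
    Q  = ⟦ quotient c e ⟧ (xs ∷ʳ (u + c))
  ... | ‵inject₁ j rewrite lookup-∷ʳ-inject₁ xs (u + c) j | lookup-∷ʳ-inject₁ xs c j =
    trans (*-congˡ (⟦quotient⟧ c e xs u))
      (solve 4 (λ x u q e → x :* (u :* q :+ e) := u :* (x :* q) :+ x :* e) refl _ _ _ _)

-- The inverse sorting permutation expressed by ranks.

count : ∀ {n} → (Fin n → Bool) → ℕ
count {zero}  b = 0
count {suc n} b = indicator (b zero) ℕ.+ count (b ∘ suc)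

count-false : ∀ n → count {n} (λ _ → false) ≡ 0
count-false zero    = ≡.refl
count-false (suc n) = count-false n

-- Stated for arbitrary `f` because the tail of `allFin` is tabulated by `suc` rather than `id`.
length-filter-tabulate : ∀ {n} {A : Set} {P : Pred A 0ℓ} (P? : Decidable P) (f : Fin n → A) →
  length (filter P? (List.tabulate f)) ≡ count (λ k → does (P? (f k)))
length-filter-tabulate {zero}  P? f = ≡.refl
length-filter-tabulate {suc n} P? f with does (P? (f zero))
... | true  = ≡.cong suc (length-filter-tabulate P? (f ∘ suc))
... | false = length-filter-tabulate P? (f ∘ suc)

greater equal-before : ∀ {n} → Vec ℕ n → Fin n → Fin n → Bool
greater      γ i k = Vec.lookup γ i ℕ.<ᵇ Vec.lookup γ k
equal-before γ i k = (toℕ k ℕ.<ᵇ toℕ i) ∧ (Vec.lookup γ k ℕ.≡ᵇ Vec.lookup γ i)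

winv≡count : ∀ {n} (γ : Vec ℕ n) i → winv γ i ≡ count (greater γ i) ℕ.+ count (equal-before γ i)
winv≡count γ i = ≡.cong₂ ℕ._+_
  (length-filter-tabulate (λ k → Vec.lookup γ i ℕ.<? Vec.lookup γ k) id)
  (length-filter-tabulate (λ k → (k Fin.<? i) ×-dec (Vec.lookup γ k ℕ.≟ Vec.lookup γ i)) id)

≤-or-> : ∀ x y → indicator (y ℕ.<ᵇ suc x) ℕ.+ indicator (x ℕ.<ᵇ y) ≡ 1
≤-or-> x       zero    = ≡.refl
≤-or-> zero    (suc y) = ≡.refl
≤-or-> (suc x) (suc y) = ≤-or-> x y

<-or->-or-≡ : ∀ x y →
  indicator (x ℕ.<ᵇ y) ℕ.+ (indicator (y ℕ.<ᵇ x) ℕ.+ indicator (x ℕ.≡ᵇ y)) ≡ 1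
<-or->-or-≡ zero    zero    = ≡.refl
<-or->-or-≡ zero    (suc y) = ≡.refl
<-or->-or-≡ (suc x) zero    = ≡.refl
<-or->-or-≡ (suc x) (suc y) = <-or->-or-≡ x y

x<ᵇx≡false : ∀ x → (x ℕ.<ᵇ x) ≡ false
x<ᵇx≡false zero    = ≡.refl
x<ᵇx≡false (suc x) = x<ᵇx≡false x

count≤+count> : ∀ {n} x (γ : Vec ℕ n) → count≤ x γ ℕ.+ count (λ k → x ℕ.<ᵇ Vec.lookup γ k) ≡ n
count≤+count> x []      = ≡.refl
count≤+count> x (y ∷ γ) = ≡.trans (rearrange (indicator (y ℕ.<ᵇ suc x)) _ (indicator (x ℕ.<ᵇ y)) _)
  (≡.cong₂ ℕ._+_ (≤-or-> x y) (count≤+count> x γ))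
  where
  rearrange : ∀ a b c d → (a ℕ.+ b) ℕ.+ (c ℕ.+ d) ≡ (a ℕ.+ c) ℕ.+ (b ℕ.+ d)
  rearrange = solve-∀

-- Every position other than `i` is sorted either after `i` or before it, and the leading `suc`
-- accounts for `i`. In the inductive step the first entry falls under exactly one of the three
-- comparisons with `y`.
below+greater+equal-before : ∀ {n} (γ : Vec ℕ n) i →
  suc (below γ i ℕ.+ (count (greater γ i) ℕ.+ count (equal-before γ i))) ≡ n
below+greater+equal-before {suc n} (x ∷ γ) zero
  rewrite x<ᵇx≡false x | count-false n | ℕ.+-identityʳ (count (λ k → x ℕ.<ᵇ Vec.lookup γ k)) =
  ≡.cong suc (count≤+count> x γ)
below+greater+equal-before {suc n} (x ∷ γ) (suc i) = ≡.trans
  (rearrange (indicator (x ℕ.<ᵇ y)) (below γ i) (indicator (y ℕ.<ᵇ x)) _ (indicator (x ℕ.≡ᵇ y)) _)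
  (≡.cong₂ ℕ._+_ (<-or->-or-≡ x y) (below+greater+equal-before γ i))
  where
  y = Vec.lookup γ i
  rearrange : ∀ a b c d e f →
    suc ((a ℕ.+ b) ℕ.+ ((c ℕ.+ d) ℕ.+ (e ℕ.+ f))) ≡ (a ℕ.+ (c ℕ.+ e)) ℕ.+ suc (b ℕ.+ (d ℕ.+ f))
  rearrange = solve-∀

δ≡below : ∀ {n} (γ : Vec ℕ n) i → n ℕ.∸ 1 ℕ.∸ winv γ i ≡ below γ i
δ≡below {n} γ i = begin
  n ℕ.∸ 1 ℕ.∸ winv γ i             ≡⟨ ≡.cong (λ m → m ℕ.∸ 1 ℕ.∸ winv γ i) (below+greater+equal-before γ i) ⟨
  below γ i ℕ.+ above ℕ.∸ winv γ i  ≡⟨ ≡.cong (below γ i ℕ.+ above ℕ.∸_) (winv≡count γ i) ⟩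
  below γ i ℕ.+ above ℕ.∸ above     ≡⟨ ℕ.m+n∸n≡m (below γ i) above ⟩
  below γ i                         ∎
  where
  open ≡.≡-Reasoning
  above = count (greater γ i) ℕ.+ count (equal-before γ i)

-- Finite enumeration of the compositions of a given degree.

box : ∀ n → ℕ → List (Vec ℕ n)
box zero    k = [] ∷ []
box (suc n) k = cartesianProductWith _∷_ (upTo (suc k)) (box n k)

∈-box : ∀ {n k} (γ : Vec ℕ n) → Vec.sum γ ≤ k → γ ∈ box n k
∈-box []      _  = here ≡.refl
∈-box (x ∷ γ) ≤k = ∈-cartesianProductWith⁺ _∷_ (∈-upTo⁺ (s≤s (ℕ.m+n≤o⇒m≤o x ≤k)))
  (∈-box γ (ℕ.m+n≤o⇒n≤o x ≤k))

compositions : ∀ n → ℕ → List (Vec ℕ n)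
compositions n k = filter (λ γ → Vec.sum γ ℕ.≟ k) (box n k)

∈-compositions : ∀ {n k} (γ : Vec ℕ n) → Vec.sum γ ≡ k → γ ∈ compositions n k
∈-compositions γ ≡.refl = ∈-filter⁺ _ (∈-box γ ℕ.≤-refl) ≡.refl

-- Unisolvence of the interpolation nodes.

record GenericParameter (D : CharZeroDomain) : Set where
  open CharZeroDomain D
  field
    r      : Carrier
    ι+rι≉0 : ∀ k m → ¬ ι (suc k) + r * ι m ≈ 0#

module Unisolvence (D : CharZeroDomain) (P : GenericParameter D) where
  open CharZeroDomain D
  open GenericParameter P
  open Polynomials D
  open PolynomialExpressions D
  open import Relation.Binary.Reasoning.Setoid setoid
  open import Algebra.Solver.Ring.NaturalCoefficients.Default commutativeSemiring
    using (solve; _:=_; _:+_; _:*_)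

  lookup-∷ʳ-cong : ∀ {n} (xs : Vec Carrier n) {x y} → x ≈ y →
    ∀ i → Vec.lookup (xs ∷ʳ x) i ≈ Vec.lookup (xs ∷ʳ y) i
  lookup-∷ʳ-cong []       x≈y zero    = x≈y
  lookup-∷ʳ-cong (_ ∷ xs) x≈y zero    = refl
  lookup-∷ʳ-cong (_ ∷ xs) x≈y (suc i) = lookup-∷ʳ-cong xs x≈y i

  -- The extra shift by c r in all coordinates appears when the last coordinate is removed.
  point : ∀ {n} → ℕ → Vec ℕ n → Vec Carrier n
  point c γ = Vec.tabulate (λ i → ι (Vec.lookup γ i) + r * ι (c ℕ.+ below γ i))

  -- A last entry 0 has rank 0, which gives the coordinate `c r`; it is sorted after all other
  -- entries, and the extra unit in their ranks is absorbed by `suc c`.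
  point-∷ʳ-zero : ∀ {n} c (γ : Vec ℕ n) i →
    Vec.lookup (point c (γ ∷ʳ 0)) i ≈ Vec.lookup (point (suc c) γ ∷ʳ (r * ι c)) i
  point-∷ʳ-zero c γ i with view i
  ... | ‵fromℕ rewrite lookup∘tabulate (λ i → ι (Vec.lookup (γ ∷ʳ 0) i) + r * ι (c ℕ.+ below (γ ∷ʳ 0) i)) (fromℕ _)
                     | lookup-∷ʳ-fromℕ γ 0 | below-∷ʳ-fromℕ-zero γ
                     | lookup-∷ʳ-fromℕ (point (suc c) γ) (r * ι c) | ℕ.+-identityʳ c =
    x≈0⇒x+y≈y _ ι-zero
  ... | ‵inject₁ j rewrite lookup∘tabulate (λ i → ι (Vec.lookup (γ ∷ʳ 0) i) + r * ι (c ℕ.+ below (γ ∷ʳ 0) i)) (inject₁ j)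
                     | lookup-∷ʳ-inject₁ γ 0 j | below-∷ʳ-inject₁ γ 0 j
                     | lookup-∷ʳ-inject₁ (point (suc c) γ) (r * ι c) j
                     | lookup∘tabulate (λ i → ι (Vec.lookup γ i) + r * ι (suc c ℕ.+ below γ i)) j
                     | ℕ.+-suc c (below γ j) = refl

  point-∷ʳ-suc : ∀ {n} c x (γ : Vec ℕ n) i →
    Vec.lookup (point c (γ ∷ʳ suc x)) i
      ≈ Vec.lookup (Vec.tail (point c (x ∷ γ)) ∷ʳ (1# + Vec.head (point c (x ∷ γ)))) i
  point-∷ʳ-suc c x γ i with view i
  ... | ‵fromℕ rewrite lookup∘tabulate (λ i → ι (Vec.lookup (γ ∷ʳ suc x) i) + r * ι (c ℕ.+ below (γ ∷ʳ suc x) i)) (fromℕ _)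
                     | lookup-∷ʳ-fromℕ γ (suc x) | below-∷ʳ-fromℕ-suc γ x
                     | lookup-∷ʳ-fromℕ (Vec.tail (point c (x ∷ γ))) (1# + Vec.head (point c (x ∷ γ))) =
    trans (+-congʳ (ι-suc x)) (+-assoc _ _ _)
  ... | ‵inject₁ j rewrite lookup∘tabulate (λ i → ι (Vec.lookup (γ ∷ʳ suc x) i) + r * ι (c ℕ.+ below (γ ∷ʳ suc x) i)) (inject₁ j)
                     | lookup-∷ʳ-inject₁ γ (suc x) j | below-∷ʳ-inject₁ γ (suc x) j
                     | lookup-∷ʳ-inject₁ (Vec.tail (point c (x ∷ γ))) (1# + Vec.head (point c (x ∷ γ))) j
                     | lookup∘tabulate (λ i → ι (Vec.lookup γ i) + r * ι (c ℕ.+ below (x ∷ γ) (suc i))) j = refl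

  VanishesUpTo : ∀ {n} → ℕ → ℕ → (Vec Carrier n → Carrier) → Set
  VanishesUpTo c d h = ∀ γ → Vec.sum γ ≤ d → h (point c γ) ≈ 0#

  fixLast-vanishes : ∀ {n d} c (e : Expr (suc n) d) →
    VanishesUpTo c d ⟦ e ⟧ → VanishesUpTo (suc c) d ⟦ fixLast (r * ι c) e ⟧
  fixLast-vanishes c e vanish γ γ≤d = begin
    ⟦ fixLast (r * ι c) e ⟧ (point (suc c) γ)  ≈⟨ ⟦fixLast⟧ (r * ι c) e _ ⟩
    ⟦ e ⟧ (point (suc c) γ ∷ʳ r * ι c)         ≈⟨ ⟦⟧-cong e (point-∷ʳ-zero c γ) ⟨
    ⟦ e ⟧ (point c (γ ∷ʳ 0))
      ≈⟨ vanish (γ ∷ʳ 0) (ℕ.≤-trans (ℕ.≤-reflexive (sum-∷ʳ γ 0)) γ≤d) ⟩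
    0#                                         ∎

  -- The rotation carries the node of `x ∷ γ` to that of `γ ∷ʳ suc x`, whose degree is larger by
  -- one. There `e` vanishes while the linear factor does not, so the quotient vanishes.
  quotient-vanishes : ∀ {n d} c (e : Expr (suc n) (suc d)) →
    VanishesUpTo c (suc d) ⟦ e ⟧ → (∀ xs → ⟦ e ⟧ (xs ∷ʳ r * ι c) ≈ 0#) →
    VanishesUpTo c d ⟦ rotate (quotient (r * ι c) e) ⟧
  quotient-vanishes c e vanish hyperplane (x ∷ γ) xγ≤d = begin
    ⟦ rotate q ⟧ (point c (x ∷ γ))         ≈⟨ ⟦rotate⟧ q z zs ⟩
    ⟦ q ⟧ (zs ∷ʳ (1# + z))                 ≈⟨ ⟦⟧-cong q (lookup-∷ʳ-cong zs 1+z≈u+rc) ⟩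
    ⟦ q ⟧ (zs ∷ʳ (u + r * ι c))            ≈⟨ x≉0∧x*y≈0⇒y≈0 (ι+rι≉0 x (count≤ x γ)) u*q≈0 ⟩
    0#                                     ∎
    where
    q  = quotient (r * ι c) e
    z  = Vec.head (point c (x ∷ γ))
    zs = Vec.tail (point c (x ∷ γ))
    -- The value of `xₙ - c r` at the node of `γ ∷ʳ suc x`; the translation by `c r` cancels.
    u  = ι (suc x) + r * ι (count≤ x γ)
    1+z≈u+rc : 1# + z ≈ u + r * ι c
    1+z≈u+rc = begin
      1# + (ι x + r * ι (c ℕ.+ count≤ x γ))
        ≈⟨ +-congˡ (+-congˡ (*-congˡ (ι-+ c (count≤ x γ)))) ⟩
      1# + (ι x + r * (ι c + ι (count≤ x γ)))
        ≈⟨ solve 5 (λ o x r c m → o :+ (x :+ r :* (c :+ m)) := ((o :+ x) :+ r :* m) :+ r :* c)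
             refl 1# (ι x) r (ι c) (ι (count≤ x γ)) ⟩
      (1# + ι x + r * ι (count≤ x γ)) + r * ι c
        ≈⟨ +-congʳ (+-congʳ (ι-suc x)) ⟨
      u + r * ι c ∎
    u*q≈0 : u * ⟦ q ⟧ (zs ∷ʳ (u + r * ι c)) ≈ 0#
    u*q≈0 = begin
      u * ⟦ q ⟧ (zs ∷ʳ (u + r * ι c))
        ≈⟨ y≈0⇒x+y≈x _ (hyperplane zs) ⟨
      u * ⟦ q ⟧ (zs ∷ʳ (u + r * ι c)) + ⟦ e ⟧ (zs ∷ʳ r * ι c)
        ≈⟨ ⟦quotient⟧ (r * ι c) e zs u ⟨
      ⟦ e ⟧ (zs ∷ʳ (u + r * ι c))
        ≈⟨ ⟦⟧-cong e (lookup-∷ʳ-cong zs 1+z≈u+rc) ⟨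
      ⟦ e ⟧ (zs ∷ʳ (1# + z))
        ≈⟨ ⟦⟧-cong e (point-∷ʳ-suc c x γ) ⟨
      ⟦ e ⟧ (point c (γ ∷ʳ suc x))
        ≈⟨ vanish (γ ∷ʳ suc x) (ℕ.≤-trans (ℕ.≤-reflexive (sum-∷ʳ γ (suc x))) (s≤s xγ≤d)) ⟩
      0# ∎

  hyperplane-zero : ∀ {n d} a (e : Expr (suc n) d) →
    (∀ xs → ⟦ fixLast a e ⟧ xs ≈ 0#) → ∀ xs → ⟦ e ⟧ (xs ∷ʳ a) ≈ 0#
  hyperplane-zero a e fixLast≈0 xs = trans (sym (⟦fixLast⟧ a e xs)) (fixLast≈0 xs)

  zero-by-division : ∀ {n d} a (e : Expr (suc n) (suc d)) →
    (∀ xs → ⟦ fixLast a e ⟧ xs ≈ 0#) → (∀ x → ⟦ rotate (quotient a e) ⟧ x ≈ 0#) →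
    ∀ x → ⟦ e ⟧ x ≈ 0#
  zero-by-division a e fixLast≈0 rotate≈0 x with Vec.initLast x
  ... | xs , y , ≡.refl = begin
    ⟦ e ⟧ (xs ∷ʳ y)                              ≈⟨ ⟦⟧-cong e (lookup-∷ʳ-cong xs (undo y a)) ⟩
    ⟦ e ⟧ (xs ∷ʳ (u + a))                        ≈⟨ ⟦quotient⟧ a e xs u ⟩
    u * ⟦ q ⟧ (xs ∷ʳ (u + a)) + ⟦ e ⟧ (xs ∷ʳ a)
      ≈⟨ 0+0≈0 (y≈0⇒x*y≈0 u (quotient≈0 (u + a))) (hyperplane-zero a e fixLast≈0 xs) ⟩
    0#                                           ∎
    where
    q = quotient a e
    u = y + - a
    undo : ∀ y a → y ≈ (y + - a) + a
    undo y a = sym (trans (+-assoc _ _ _) (y≈0⇒x+y≈x y (-‿inverseˡ a)))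
    -- The rotation is invertible: the last coordinate `y` comes from the first coordinate `y - 1`.
    quotient≈0 : ∀ y → ⟦ q ⟧ (xs ∷ʳ y) ≈ 0#
    quotient≈0 y = begin
      ⟦ q ⟧ (xs ∷ʳ y)                  ≈⟨ ⟦⟧-cong q (lookup-∷ʳ-cong xs (trans (undo y 1#) (+-comm _ _))) ⟩
      ⟦ q ⟧ (xs ∷ʳ (1# + (y + - 1#)))  ≈⟨ ⟦rotate⟧ q (y + - 1#) xs ⟨
      ⟦ rotate q ⟧ ((y + - 1#) ∷ xs)   ≈⟨ rotate≈0 _ ⟩
      0#                               ∎

  -- The points with γₙ = 0 lie on the hyperplane xₙ = c r, where induction on n applies; the
  -- other points are images of points of smaller degree under the affine map
  -- x ↦ (x₂, …, xₙ, x₁ + 1), so that induction on the degree applies after division by xₙ - c r.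
  ⟦⟧-unisolvent : ∀ {n d} c (e : Expr n d) → VanishesUpTo c d ⟦ e ⟧ → ∀ x → ⟦ e ⟧ x ≈ 0#
  ⟦⟧-unisolvent {zero} c e vanish [] = vanish [] z≤n
  ⟦⟧-unisolvent {suc n} {zero} c e vanish x =
    -- A constant may be evaluated at a point of the hyperplane instead, where induction on `n`
    -- applies.
    trans (⟦⟧-degree-zero e x (Vec.tail x ∷ʳ r * ι c))
      (hyperplane-zero (r * ι c) e
        (⟦⟧-unisolvent (suc c) (fixLast (r * ι c) e) (fixLast-vanishes c e vanish)) (Vec.tail x))
  ⟦⟧-unisolvent {suc n} {suc d} c e vanish =
    zero-by-division (r * ι c) e fixLast≈0
      (⟦⟧-unisolvent c (rotate (quotient (r * ι c) e))
        (quotient-vanishes c e vanish (hyperplane-zero (r * ι c) e fixLast≈0)))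
    where
    fixLast≈0 = ⟦⟧-unisolvent (suc c) (fixLast (r * ι c) e) (fixLast-vanishes c e vanish)

  bar : ∀ {n} → Vec ℕ n → Vec Carrier n
  bar {n} γ = Vec.tabulate (λ i → ι (Vec.lookup γ i) + r * ι (n ℕ.∸ 1 ℕ.∸ winv γ i))

  point≈bar : ∀ {n} (γ : Vec ℕ n) i → Vec.lookup (point 0 γ) i ≈ Vec.lookup (bar γ) i
  point≈bar {n} γ i
    rewrite lookup∘tabulate (λ i → ι (Vec.lookup γ i) + r * ι (n ℕ.∸ 1 ℕ.∸ winv γ i)) i
          | lookup∘tabulate (λ i → ι (Vec.lookup γ i) + r * ι (below γ i)) i
          | δ≡below γ i = refl

  unisolvent : ∀ {n} d (p : Poly n) → DegLe d p →
    (∀ γ → Vec.sum γ ≤ d → eval p (bar γ) ≈ 0#) → ∀ μ → coeff p μ ≈ 0#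
  unisolvent {n} d p p≤d vanish μ = trans (p≈q μ) (eval≈0⇒≈P0 q (λ x → trans (sym (⟦toExpr⟧ q q≤d x))
    (⟦⟧-unisolvent 0 (toExpr q q≤d) (λ γ γ≤d → begin
      ⟦ toExpr q q≤d ⟧ (point 0 γ)  ≈⟨ ⟦toExpr⟧ q q≤d (point 0 γ) ⟩
      eval q (point 0 γ)            ≈⟨ eval-cong p q p≈q (point 0 γ) ⟨
      eval p (point 0 γ)            ≈⟨ eval-cong-arg p (point 0 γ) (bar γ) (point≈bar γ) ⟩
      eval p (bar γ)                ≈⟨ vanish γ γ≤d ⟩
      0#                            ∎) x)) μ)
    where
    -- `p` may list terms of degree above `d` that cancel. They are discarded, because `toExpr`
    -- needs the bound on every listed term.
    q = filter (λ t → Vec.sum (proj₁ t) ℕ.≤? d) p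
    q≤d : All (λ t → Vec.sum (proj₁ t) ≤ d) q
    q≤d = All.all-filter (λ t → Vec.sum (proj₁ t) ℕ.≤? d) p
    p≈q : p ≈P q
    p≈q μ with Vec.sum μ ℕ.≤? d
    ... | yes μ≤d = sym (coeff-filter (λ μ → Vec.sum μ ℕ.≤? d) p μ≤d)
    ... | no  μ≰d = trans (p≤d μ (ℕ.≰⇒> μ≰d)) (sym (coeff-filter-no (λ μ → Vec.sum μ ℕ.≤? d) p μ≰d))

-- Newton interpolation and the two characterising properties.

module Interpolation (D : CharZeroDomain) (P : GenericParameter D) where
  open CharZeroDomain D
  open GenericParameter P
  open Polynomials D
  open Unisolvence D P
  open import Relation.Binary.Reasoning.Setoid setoid
  open import Algebra.Solver.Ring.NaturalCoefficients.Default commutativeSemiring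
    using (solve; _:=_; _:+_; _:*_)
  open import Algebra.Properties.Ring ring using (-1*x≈-x; -‿involutive)

  -- The weight w is d_η.
  module Characterization {n} (inverse : ∀ x → ¬ x ≈ 0# → ∃ λ y → y * x ≈ 1#)
    (E : Vec ℕ n → Poly n)
    (E-degree : ∀ η → DegLe (Vec.sum η) (E η))
    (E-monic : ∀ η → coeff (E η) η ≈ 1#)
    (E-vanish : ∀ η γ → γ ≢ η → Vec.sum γ ≤ Vec.sum η → eval (E η) (bar γ) ≈ 0#)
    (w : Vec ℕ n → Carrier) (w≉0 : ∀ η → ¬ w η ≈ 0#)
    (Ξ : Poly n → Poly n)
    (Ξ-cong : ∀ p q → p ≈P q → Ξ p ≈P Ξ q)
    (Ξ-++ : ∀ p q → Ξ (p ++ q) ≈P Ξ p ++ Ξ q)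
    (Ξ-scale : ∀ c p → Ξ (scaleP c p) ≈P scaleP c (Ξ p))
    (Ξ-F : ∀ η → Ξ (scaleP (w η) (topComp (Vec.sum η) (E η)))
               ≈P scaleP (sign (Vec.sum η) * w η) (negArg (E η)))
    where

    -- One more zero at the node of `η` would make `E η` vanish at all nodes of degree at most that
    -- of `η`, hence be zero, against its coefficient 1.
    E-bar≉0 : ∀ η → ¬ eval (E η) (bar η) ≈ 0#
    E-bar≉0 η root = 1≉0 (trans (sym (E-monic η))
      (unisolvent (Vec.sum η) (E η) (E-degree η) vanish η))
      where
      vanish : ∀ γ → Vec.sum γ ≤ Vec.sum η → eval (E η) (bar γ) ≈ 0#
      vanish γ γ≤η with ≡-dec ℕ._≟_ γ η
      ... | yes ≡.refl = root
      ... | no  γ≢η    = E-vanish η γ γ≢η γ≤η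

    sign² : ∀ k → sign k * sign k ≈ 1#
    sign² zero    = *-identityˡ 1#
    sign² (suc k) = begin
      (- 1# * sign k) * (- 1# * sign k)  ≈⟨ solve 2 (λ e s → (e :* s) :* (e :* s) := (e :* e) :* (s :* s)) refl _ _ ⟩
      (- 1# * - 1#) * (sign k * sign k)  ≈⟨ *-cong (trans (-1*x≈-x (- 1#)) (-‿involutive 1#)) (sign² k) ⟩
      1# * 1#                            ≈⟨ *-identityˡ 1# ⟩
      1#                                 ∎

    coeff-topComp : ∀ d (p : Poly n) {μ} → Vec.sum μ ≡ d → coeff (topComp d p) μ ≈ coeff p μ
    coeff-topComp d = coeff-filter (λ μ → Vec.sum μ ℕ.≟ d)

    coeff-topComp-≢ : ∀ d (p : Poly n) {μ} → Vec.sum μ ≢ d → coeff (topComp d p) μ ≈ 0#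
    coeff-topComp-≢ d = coeff-filter-no (λ μ → Vec.sum μ ℕ.≟ d)

    negV : Vec Carrier n → Vec Carrier n
    negV = Vec.map -_

    eval-negV-negV : ∀ (p : Poly n) x → eval p (negV (negV x)) ≈ eval p x
    eval-negV-negV p x = eval-cong-arg p (negV (negV x)) x λ i → trans
      (reflexive (≡.trans (lookup-map i -_ (negV x)) (≡.cong -_ (lookup-map i -_ x)))) (-‿involutive _)

    VanishBelow : ℕ → Poly n → Set
    VanishBelow d p = ∀ γ → Vec.sum γ < d → eval p (negV (bar γ)) ≈ 0#

    module _ (d : ℕ) where

      -- for h homogeneous of degree d: the two properties that characterise Ξ h
      Good : Poly n → Set
      Good h = (∀ μ → d ≤ Vec.sum μ → coeff (Ξ h) μ ≈ coeff h μ) × VanishBelow d (Ξ h)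

      good-cong : ∀ h h′ → h ≈P h′ → Good h → Good h′
      good-cong h h′ h≈h′ (top , vanish) =
        (λ μ d≤μ → trans (sym (Ξ-cong h h′ h≈h′ μ)) (trans (top μ d≤μ) (h≈h′ μ))) ,
        (λ γ γ<d → trans (sym (eval-cong (Ξ h) (Ξ h′) (Ξ-cong h h′ h≈h′) (negV (bar γ)))) (vanish γ γ<d))

      good-++ : ∀ h h′ → Good h → Good h′ → Good (h ++ h′)
      good-++ h h′ (top , vanish) (top′ , vanish′) =
        (λ μ d≤μ → begin
          coeff (Ξ (h ++ h′)) μ          ≈⟨ Ξ-++ h h′ μ ⟩
          coeff (Ξ h ++ Ξ h′) μ          ≈⟨ coeff-++ (Ξ h) (Ξ h′) μ ⟩
          coeff (Ξ h) μ + coeff (Ξ h′) μ ≈⟨ +-cong (top μ d≤μ) (top′ μ d≤μ) ⟩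
          coeff h μ + coeff h′ μ         ≈⟨ coeff-++ h h′ μ ⟨
          coeff (h ++ h′) μ              ∎) ,
        (λ γ γ<d → begin
          eval (Ξ (h ++ h′)) (negV (bar γ))
            ≈⟨ eval-cong (Ξ (h ++ h′)) (Ξ h ++ Ξ h′) (Ξ-++ h h′) (negV (bar γ)) ⟩
          eval (Ξ h ++ Ξ h′) (negV (bar γ))
            ≈⟨ eval-++ (Ξ h) (Ξ h′) (negV (bar γ)) ⟩
          eval (Ξ h) (negV (bar γ)) + eval (Ξ h′) (negV (bar γ))
            ≈⟨ 0+0≈0 (vanish γ γ<d) (vanish′ γ γ<d) ⟩
          0# ∎)

      good-scale : ∀ c h → Good h → Good (scaleP c h)
      good-scale c h (top , vanish) =
        (λ μ d≤μ → begin
          coeff (Ξ (scaleP c h)) μ   ≈⟨ Ξ-scale c h μ ⟩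
          coeff (scaleP c (Ξ h)) μ   ≈⟨ coeff-reweight _ (Ξ h) μ ⟩
          c * coeff (Ξ h) μ          ≈⟨ *-congˡ (top μ d≤μ) ⟩
          c * coeff h μ              ≈⟨ coeff-reweight _ h μ ⟨
          coeff (scaleP c h) μ       ∎) ,
        (λ γ γ<d → begin
          eval (Ξ (scaleP c h)) (negV (bar γ))
            ≈⟨ eval-cong (Ξ (scaleP c h)) (scaleP c (Ξ h)) (Ξ-scale c h) (negV (bar γ)) ⟩
          eval (scaleP c (Ξ h)) (negV (bar γ))
            ≈⟨ eval-scale c (Ξ h) (negV (bar γ)) ⟩
          c * eval (Ξ h) (negV (bar γ))
            ≈⟨ y≈0⇒x*y≈0 c (vanish γ γ<d) ⟩
          0# ∎)

      good-zero : ∀ h → (∀ μ → coeff h μ ≈ 0#) → Good h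
      good-zero h h≈0 = good-cong [] h (λ μ → sym (h≈0 μ))
        ((λ μ _ → Ξ[]≈0 μ) , (λ γ _ → eval-cong (Ξ []) [] Ξ[]≈0 (negV (bar γ))))
        where
        Ξ[]≈0 : Ξ [] ≈P []
        -- `scaleP 0# []` is `[]` by computation, so homogeneity with scalar 0 applies.
        Ξ[]≈0 μ = trans (Ξ-scale 0# [] μ) (trans (coeff-reweight _ (Ξ []) μ) (zeroˡ _))

      -- In degree `d` the sign in the scalar cancels the sign from negating the variables, leaving
      -- the top component. The negated nodes undo the negated argument, and a node of degree below
      -- `d` differs from that of `η`, so `E η` vanishes there.
      good-F : ∀ η → Vec.sum η ≡ d → Good (scaleP (w η) (topComp (Vec.sum η) (E η)))
      good-F η ≡.refl = top , vanish
        where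
        F = scaleP (w η) (topComp d (E η))
        G = scaleP (sign d * w η) (negArg (E η))
        coeff-G : ∀ μ → coeff G μ ≈ sign d * w η * (sign (Vec.sum μ) * coeff (E η) μ)
        coeff-G μ = trans (coeff-reweight _ (negArg (E η)) μ) (*-congˡ (coeff-reweight _ (E η) μ))
        top : ∀ μ → d ≤ Vec.sum μ → coeff (Ξ F) μ ≈ coeff F μ
        top μ d≤μ with Vec.sum μ ℕ.≟ d
        ... | yes μ≡d = begin
          coeff (Ξ F) μ                                         ≈⟨ Ξ-F η μ ⟩
          coeff G μ                                             ≈⟨ coeff-G μ ⟩
          sign d * w η * (sign (Vec.sum μ) * coeff (E η) μ)
            ≡⟨ ≡.cong (λ k → sign d * w η * (sign k * coeff (E η) μ)) μ≡d ⟩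
          sign d * w η * (sign d * coeff (E η) μ)
            ≈⟨ solve 3 (λ s w e → s :* w :* (s :* e) := (s :* s) :* (w :* e)) refl _ _ _ ⟩
          (sign d * sign d) * (w η * coeff (E η) μ)
            ≈⟨ trans (*-congʳ (sign² d)) (*-identityˡ _) ⟩
          w η * coeff (E η) μ                                   ≈⟨ *-congˡ (coeff-topComp d (E η) μ≡d) ⟨
          w η * coeff (topComp d (E η)) μ                       ≈⟨ coeff-reweight _ (topComp d (E η)) μ ⟨
          coeff F μ                                             ∎
        ... | no μ≢d = begin
          coeff (Ξ F) μ                                         ≈⟨ Ξ-F η μ ⟩
          coeff G μ                                             ≈⟨ coeff-G μ ⟩
          sign d * w η * (sign (Vec.sum μ) * coeff (E η) μ)
            ≈⟨ y≈0⇒x*y≈0 _ (y≈0⇒x*y≈0 _ (E-degree η μ (ℕ.≤∧≢⇒< d≤μ (μ≢d ∘ ≡.sym)))) ⟩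
          0#                                                    ≈⟨ y≈0⇒x*y≈0 _ (coeff-topComp-≢ d (E η) μ≢d) ⟨
          w η * coeff (topComp d (E η)) μ                       ≈⟨ coeff-reweight _ (topComp d (E η)) μ ⟨
          coeff F μ                                             ∎
        vanish : VanishBelow d (Ξ F)
        vanish γ γ<d = begin
          eval (Ξ F) (negV (bar γ))
            ≈⟨ eval-cong (Ξ F) G (Ξ-F η) (negV (bar γ)) ⟩
          eval G (negV (bar γ))
            ≈⟨ eval-scale _ (negArg (E η)) (negV (bar γ)) ⟩
          sign d * w η * eval (negArg (E η)) (negV (bar γ))
            ≈⟨ *-congˡ (trans (eval-negArg (E η) (negV (bar γ))) (eval-negV-negV (E η) (bar γ))) ⟩
          sign d * w η * eval (E η) (bar γ)
            ≈⟨ y≈0⇒x*y≈0 _ (E-vanish η γ (λ { ≡.refl → ℕ.<-irrefl ≡.refl γ<d }) (ℕ.<⇒≤ γ<d)) ⟩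
          0# ∎

      -- For `η` of degree `d` the nonzero weight is divided out of `good-F`; for smaller degree the
      -- component is zero.
      good-topComp-E : ∀ η → Vec.sum η ≤ d → Good (topComp d (E η))
      good-topComp-E η η≤d with Vec.sum η ℕ.≟ d
      ... | yes ≡.refl = good-cong (scaleP w⁻¹ (scaleP (w η) (topComp d (E η)))) _
        (λ μ → begin
          coeff (scaleP w⁻¹ (scaleP (w η) (topComp d (E η)))) μ
            ≈⟨ trans (coeff-reweight _ (scaleP (w η) (topComp d (E η))) μ)
                 (*-congˡ (coeff-reweight _ (topComp d (E η)) μ)) ⟩
          w⁻¹ * (w η * coeff (topComp d (E η)) μ)  ≈⟨ *-assoc _ _ _ ⟨
          w⁻¹ * w η * coeff (topComp d (E η)) μ    ≈⟨ *-congʳ w⁻¹*w≈1 ⟩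
          1# * coeff (topComp d (E η)) μ           ≈⟨ *-identityˡ _ ⟩
          coeff (topComp d (E η)) μ                ∎)
        (good-scale w⁻¹ _ (good-F η ≡.refl))
        where
        w⁻¹ = proj₁ (inverse (w η) (w≉0 η))
        w⁻¹*w≈1 = proj₂ (inverse (w η) (w≉0 η))
      ... | no η≢d = good-zero _ zero-top
        where
        zero-top : ∀ μ → coeff (topComp d (E η)) μ ≈ 0#
        zero-top μ with Vec.sum μ ℕ.≟ d
        ... | yes ≡.refl = trans (coeff-topComp d (E η) ≡.refl) (E-degree η μ (ℕ.≤∧≢⇒< η≤d η≢d))
        ... | no μ≢d = coeff-topComp-≢ d (E η) μ≢d

      -- Takes back one subtraction of the interpolation, so that goodness of the remainder passes
      -- to `p`.
      good-topComp-restore : ∀ c p η → Vec.sum η ≤ d →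
        Good (topComp d (p -P scaleP c (E η))) → Good (topComp d p)
      good-topComp-restore c p η η≤d good = good-cong
        (topComp d (p -P scaleP c (E η)) ++ scaleP c (topComp d (E η))) (topComp d p) same
        (good-++ _ _ good (good-scale c _ (good-topComp-E η η≤d)))
        where
        sum-coeff : ∀ μ → coeff (topComp d (p -P scaleP c (E η)) ++ scaleP c (topComp d (E η))) μ ≈
          coeff (topComp d (p -P scaleP c (E η))) μ + c * coeff (topComp d (E η)) μ
        sum-coeff μ = trans (coeff-++ (topComp d (p -P scaleP c (E η))) _ μ)
          (+-congˡ (coeff-reweight _ (topComp d (E η)) μ))
        same : topComp d (p -P scaleP c (E η)) ++ scaleP c (topComp d (E η)) ≈P topComp d p
        same μ with Vec.sum μ ℕ.≟ d
        ... | yes μ≡d = begin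
          _ ≈⟨ sum-coeff μ ⟩
          coeff (topComp d (p -P scaleP c (E η))) μ + c * coeff (topComp d (E η)) μ
            ≈⟨ +-cong (coeff-topComp d (p -P scaleP c (E η)) μ≡d) (*-congˡ (coeff-topComp d (E η) μ≡d)) ⟩
          coeff (p -P scaleP c (E η)) μ + c * coeff (E η) μ
            ≈⟨ +-congʳ (trans (coeff-minus p _ μ) (+-congˡ (*-congˡ (coeff-reweight _ (E η) μ)))) ⟩
          coeff p μ + - 1# * (c * coeff (E η) μ) + c * coeff (E η) μ
            ≈⟨ +-assoc _ _ _ ⟩
          coeff p μ + (- 1# * (c * coeff (E η) μ) + c * coeff (E η) μ)
            ≈⟨ y≈0⇒x+y≈x _ (trans (+-comm _ _) (x≈y⇒x-y≈0 refl)) ⟩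
          coeff p μ
            ≈⟨ coeff-topComp d p μ≡d ⟨
          coeff (topComp d p) μ ∎
        ... | no μ≢d = begin
          _ ≈⟨ sum-coeff μ ⟩
          coeff (topComp d (p -P scaleP c (E η))) μ + c * coeff (topComp d (E η)) μ
            ≈⟨ 0+0≈0 (coeff-topComp-≢ d (p -P scaleP c (E η)) μ≢d)
                 (y≈0⇒x*y≈0 c (coeff-topComp-≢ d (E η) μ≢d)) ⟩
          0#
            ≈⟨ coeff-topComp-≢ d p μ≢d ⟨
          coeff (topComp d p) μ ∎

      -- Treats the nodes of degree `k` one at a time: subtracting a multiple of `E η` clears the
      -- node of `η` and leaves the values at all other nodes of degree at most `k` unchanged. `L`
      -- lists the nodes still to be cleared, and `next` continues in degree `suc k`.
      clear-level : ∀ {k} → k ≤ d →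
        (∀ p → DegLe d p → (∀ γ → Vec.sum γ < suc k → eval p (bar γ) ≈ 0#) → Good (topComp d p)) →
        ∀ L → All (λ η → Vec.sum η ≡ k) L →
        ∀ p → DegLe d p → (∀ γ → Vec.sum γ < k → eval p (bar γ) ≈ 0#) →
        (∀ γ → Vec.sum γ ≡ k → γ ∈ L ⊎ eval p (bar γ) ≈ 0#) → Good (topComp d p)
      clear-level k≤d next [] [] p p≤d vanish level = next p p≤d vanish′
        where
        vanish′ : ∀ γ → Vec.sum γ < suc _ → eval p (bar γ) ≈ 0#
        vanish′ γ (s≤s γ≤k) with ℕ.m≤n⇒m<n∨m≡n γ≤k
        ... | inj₁ γ<k = vanish γ γ<k
        ... | inj₂ γ≡k with level γ γ≡k
        ...   | inj₂ pγ≈0 = pγ≈0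
      clear-level k≤d next (η ∷ L) (≡.refl ∷ L≡k) p p≤d vanish level =
        good-topComp-restore c p η k≤d
          (clear-level k≤d next L L≡k q q≤d
            (λ γ γ<k → q-vanish γ (λ { ≡.refl → ℕ.<-irrefl ≡.refl γ<k }) (ℕ.<⇒≤ γ<k) (vanish γ γ<k))
            level′)
        where
        e⁻¹ = proj₁ (inverse (eval (E η) (bar η)) (E-bar≉0 η))
        e⁻¹*e≈1 = proj₂ (inverse (eval (E η) (bar η)) (E-bar≉0 η))
        -- Chosen so that `c * eval (E η) (bar η)` is the value of `p` at the node of `η`.
        c = eval p (bar η) * e⁻¹
        q = p -P scaleP c (E η)
        eval-q : ∀ x → eval q x ≈ eval p x + - 1# * (c * eval (E η) x)
        eval-q x = trans (eval-minus p _ x) (+-congˡ (*-congˡ (eval-scale c (E η) x)))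
        q≤d : DegLe d q
        q≤d μ d<μ = begin
          coeff q μ                                       ≈⟨ coeff-minus p _ μ ⟩
          coeff p μ + - 1# * coeff (scaleP c (E η)) μ     ≈⟨ +-congˡ (*-congˡ (coeff-reweight _ (E η) μ)) ⟩
          coeff p μ + - 1# * (c * coeff (E η) μ)
            ≈⟨ 0+0≈0 (p≤d μ d<μ) (y≈0⇒x*y≈0 _ (y≈0⇒x*y≈0 c (E-degree η μ (ℕ.≤-<-trans k≤d d<μ)))) ⟩
          0#                                              ∎
        q-vanish : ∀ γ → γ ≢ η → Vec.sum γ ≤ Vec.sum η → eval p (bar γ) ≈ 0# → eval q (bar γ) ≈ 0#
        q-vanish γ γ≢η γ≤η pγ≈0 = trans (eval-q (bar γ))
          (0+0≈0 pγ≈0 (y≈0⇒x*y≈0 _ (y≈0⇒x*y≈0 c (E-vanish η γ γ≢η γ≤η))))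
        level′ : ∀ γ → Vec.sum γ ≡ Vec.sum η → γ ∈ L ⊎ eval q (bar γ) ≈ 0#
        level′ γ γ≡k with ≡-dec ℕ._≟_ γ η
        ... | yes ≡.refl = inj₂ (trans (eval-q (bar η)) (x≈y⇒x-y≈0 (begin
          eval p (bar η)                                       ≈⟨ *-identityʳ _ ⟨
          eval p (bar η) * 1#                                  ≈⟨ *-congˡ e⁻¹*e≈1 ⟨
          eval p (bar η) * (e⁻¹ * eval (E η) (bar η))          ≈⟨ *-assoc _ _ _ ⟨
          c * eval (E η) (bar η)                               ∎)))
        ... | no γ≢η with level γ γ≡k
        ...   | inj₁ (here γ≡η)  = ⊥-elim (γ≢η γ≡η)
        ...   | inj₁ (there γ∈L) = inj₁ γ∈L
        ...   | inj₂ pγ≈0        = inj₂ (q-vanish γ γ≢η (ℕ.≤-reflexive γ≡k) pγ≈0)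

      -- Newton interpolation: subtracting multiples of E η for |η| = k makes p vanish in degree k.
      good-topComp : ∀ j k → j ℕ.+ k ≡ suc d → ∀ p → DegLe d p →
        (∀ γ → Vec.sum γ < k → eval p (bar γ) ≈ 0#) → Good (topComp d p)
      -- Here `k` is `suc d`, so `p` vanishes at every node of degree at most `d` and is zero by
      -- unisolvence.
      good-topComp zero    _ ≡.refl p p≤d vanish = good-zero _ zero-top
        where
        zero-top : ∀ μ → coeff (topComp d p) μ ≈ 0#
        zero-top μ with Vec.sum μ ℕ.≟ d
        ... | yes μ≡d = trans (coeff-topComp d p μ≡d) (unisolvent d p p≤d (λ γ γ≤d → vanish γ (s≤s γ≤d)) μ)
        ... | no  μ≢d = coeff-topComp-≢ d p μ≢d
      good-topComp (suc j) k j+k≡d p p≤d vanish = clear-level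
        (≡.subst (k ≤_) (ℕ.suc-injective j+k≡d) (ℕ.m≤n+m k j))
        (good-topComp j (suc k) (≡.trans (ℕ.+-suc j k) j+k≡d))
        (compositions n k) (All.all-filter (λ γ → Vec.sum γ ℕ.≟ k) (box n k)) p p≤d vanish
        (λ γ γ≡k → inj₁ (∈-compositions γ γ≡k))

      good-homogeneous : ∀ f → IsHomog d f → Good f
      good-homogeneous f hom = good-cong (topComp d f) f same
        (good-topComp (suc d) 0 (ℕ.+-identityʳ (suc d)) f
          (λ μ d<μ → hom μ (λ { ≡.refl → ℕ.<-irrefl ≡.refl d<μ })) (λ γ ()))
        where
        same : topComp d f ≈P f
        same μ with Vec.sum μ ℕ.≟ d
        ... | yes μ≡d = coeff-topComp d f μ≡d
        ... | no  μ≢d = trans (coeff-topComp-≢ d f μ≢d) (sym (hom μ μ≢d))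

    -- Degree below `suc d` is degree at most `d`, so unisolvence applies to `negArg h`, whose
    -- coefficients differ from those of `h` by signs.
    low-degree-zero : ∀ d (h : Poly n) → DegLt d h → VanishBelow d h → ∀ μ → coeff h μ ≈ 0#
    low-degree-zero zero    h h<d vanish μ = h<d μ z≤n
    low-degree-zero (suc d) h h<d vanish μ = begin
      coeff h μ                                ≈⟨ *-identityˡ _ ⟨
      1# * coeff h μ                           ≈⟨ *-congʳ (sign² (Vec.sum μ)) ⟨
      sign (Vec.sum μ) * sign (Vec.sum μ) * coeff h μ
        ≈⟨ *-assoc _ _ _ ⟩
      sign (Vec.sum μ) * (sign (Vec.sum μ) * coeff h μ)
        ≈⟨ *-congˡ (coeff-reweight _ h μ) ⟨
      sign (Vec.sum μ) * coeff (negArg h) μ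
        ≈⟨ y≈0⇒x*y≈0 _ (unisolvent d (negArg h)
             (λ μ d<μ → trans (coeff-reweight _ h μ) (y≈0⇒x*y≈0 _ (h<d μ d<μ)))
             (λ γ γ≤d → trans (eval-negArg h (bar γ)) (vanish γ (s≤s γ≤d))) μ) ⟩
      0# ∎

    characterization : ∀ d f → IsHomog d f →
      (DegLt d (Ξ f -P f) × VanishBelow d (Ξ f)) ×
      (∀ g → DegLt d (g -P f) → VanishBelow d g → g ≈P Ξ f)
    characterization d f hom = (degree , vanish) , unique
      where
      top = proj₁ (good-homogeneous d f hom)
      vanish = proj₂ (good-homogeneous d f hom)
      degree : DegLt d (Ξ f -P f)
      degree μ d≤μ = trans (coeff-minus (Ξ f) f μ) (x≈y⇒x-y≈0 (top μ d≤μ))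
      unique : ∀ g → DegLt d (g -P f) → VanishBelow d g → g ≈P Ξ f
      unique g g-f<d g-vanish μ = x-y≈0⇒x≈y (trans (sym (coeff-minus g (Ξ f) μ))
        (low-degree-zero d (g -P Ξ f)
          -- In degrees at least `d` both `g` and `Ξ f` agree with `f`.
          (λ μ d≤μ → trans (coeff-minus g (Ξ f) μ) (x≈y⇒x-y≈0
            (trans (x-y≈0⇒x≈y (trans (sym (coeff-minus g f μ)) (g-f<d μ d≤μ))) (sym (top μ d≤μ)))))
          (λ γ γ<d → trans (eval-minus g (Ξ f) (negV (bar γ)))
            (0+0≈0 (g-vanish γ γ<d) (y≈0⇒x*y≈0 _ (vanish γ γ<d)))) μ))

-- The field of rational functions.

-- The `fraction` identities are laws for a/m, b/k, c/l with denominators cleared;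
-- `fraction-+-split` and `fraction-+-merge` serve the compatibility of addition with equality of
-- fractions.
module FractionLaws (R : CommutativeRing 0ℓ 0ℓ) where
  open CommutativeRing R
  open import Algebra.Solver.Ring.NaturalCoefficients.Default commutativeSemiring
    using (solve; con; _:=_; _:+_; _:*_)

  fraction-+-assoc : ∀ a m b k c l →
    ((a * k + b * m) * l + c * (m * k)) * (m * (k * l)) ≈
    (a * (k * l) + (b * l + c * k) * m) * (m * k * l)
  fraction-+-assoc = solve 6 (λ a m b k c l →
    ((a :* k :+ b :* m) :* l :+ c :* (m :* k)) :* (m :* (k :* l)) :=
    (a :* (k :* l) :+ (b :* l :+ c :* k) :* m) :* (m :* k :* l)) refl

  fraction-+-comm : ∀ a m b k → (a * k + b * m) * (k * m) ≈ (b * m + a * k) * (m * k)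
  fraction-+-comm = solve 4 (λ a m b k →
    (a :* k :+ b :* m) :* (k :* m) := (b :* m :+ a :* k) :* (m :* k)) refl

  fraction-*-assoc : ∀ a m b k c l → (a * b * c) * (m * (k * l)) ≈ (a * (b * c)) * (m * k * l)
  fraction-*-assoc = solve 6 (λ a m b k c l →
    (a :* b :* c) :* (m :* (k :* l)) := (a :* (b :* c)) :* (m :* k :* l)) refl

  fraction-*-comm : ∀ a m b k → (a * b) * (k * m) ≈ (b * a) * (m * k)
  fraction-*-comm = solve 4 (λ a m b k → (a :* b) :* (k :* m) := (b :* a) :* (m :* k)) refl

  fraction-distrib : ∀ a m b k c l →
    (a * (b * l + c * k)) * ((m * k) * (m * l)) ≈
    ((a * b) * (m * l) + (a * c) * (m * k)) * (m * (k * l))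
  fraction-distrib = solve 6 (λ a m b k c l →
    (a :* (b :* l :+ c :* k)) :* ((m :* k) :* (m :* l)) :=
    ((a :* b) :* (m :* l) :+ (a :* c) :* (m :* k)) :* (m :* (k :* l))) refl

  fraction-+-split : ∀ a m b k m′ k′ →
    (a * k + b * m) * (m′ * k′) ≈ (a * m′) * (k * k′) + (b * k′) * (m * m′)
  fraction-+-split = solve 6 (λ a m b k m′ k′ →
    (a :* k :+ b :* m) :* (m′ :* k′) := (a :* m′) :* (k :* k′) :+ (b :* k′) :* (m :* m′)) refl

  fraction-+-merge : ∀ a m b k m′ k′ →
    (a * m′) * (k′ * k) + (b * k′) * (m′ * m) ≈ (a * k + b * m) * (m′ * k′)
  fraction-+-merge = solve 6 (λ a m b k m′ k′ →
    (a :* m′) :* (k′ :* k) :+ (b :* k′) :* (m′ :* m) := (a :* k :+ b :* m) :* (m′ :* k′)) refl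

  *-interchange : ∀ a b c d → (a * b) * (c * d) ≈ (a * c) * (b * d)
  *-interchange = solve 4 (λ a b c d → (a :* b) :* (c :* d) := (a :* c) :* (b :* d)) refl

  fraction-+-identityˡ : ∀ a m → (0# * m + a * 1#) * m ≈ a * (1# * m)
  fraction-+-identityˡ a m = trans
    (*-congʳ (trans (+-cong (zeroˡ m) (*-identityʳ a)) (+-identityˡ a)))
    (*-congˡ (sym (*-identityˡ m)))

  rotate₃ : ∀ k a l → k * (a * l) ≈ (a * k) * l
  rotate₃ = solve 3 (λ k a l → k :* (a :* l) := (a :* k) :* l) refl

  swap-right : ∀ a b c → (a * b) * c ≈ (a * c) * b
  swap-right = solve 3 (λ a b c → (a :* b) :* c := (a :* c) :* b) refl

  horner-∷-⊗ : ∀ a p q t → a * q + (0# + t * (p * q)) ≈ (a + t * p) * q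
  horner-∷-⊗ = solve 4 (λ a p q t → a :* q :+ (con 0 :+ t :* (p :* q)) := (a :+ t :* p) :* q) refl

  horner-∷-⊕ : ∀ a b p q t → (a + b) + t * (p + q) ≈ (a + t * p) + (b + t * q)
  horner-∷-⊕ = solve 5 (λ a b p q t → (a :+ b) :+ t :* (p :+ q) := (a :+ t :* p) :+ (b :+ t :* q)) refl

  horner-∷-scale : ∀ c a t p → c * a + t * (c * p) ≈ c * (a + t * p)
  horner-∷-scale = solve 4 (λ c a t p → c :* a :+ t :* (c :* p) := c :* (a :+ t :* p)) refl

open import Defs

open FractionLaws ℚ.+-*-commutativeRing

fromℕ-suc : ∀ k → + suc k ℚ./ 1 ≡ 1ℚ ℚ.+ + k ℚ./ 1
fromℕ-suc k = ℚ.toℚᵘ-injective (begin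
  ℚ.toℚᵘ (+ suc k ℚ./ 1)              ≈⟨ ℚ.toℚᵘ-fromℚᵘ (ℚᵘ.mkℚᵘ (+ suc k) 0) ⟩
  ℚᵘ.mkℚᵘ (+ suc k) 0                 ≈⟨ ℚᵘ.*≡* (≡.cong (λ i → i ℤ.* + 1) num≡) ⟩
  ℚᵘ.1ℚᵘ ℚᵘ.+ ℚᵘ.mkℚᵘ (+ k) 0          ≈⟨ ℚᵘ.+-congʳ ℚᵘ.1ℚᵘ (ℚ.toℚᵘ-fromℚᵘ (ℚᵘ.mkℚᵘ (+ k) 0)) ⟨
  ℚᵘ.1ℚᵘ ℚᵘ.+ ℚ.toℚᵘ (+ k ℚ./ 1)      ≈⟨ ℚ.toℚᵘ-homo-+ 1ℚ (+ k ℚ./ 1) ⟨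
  ℚ.toℚᵘ (1ℚ ℚ.+ + k ℚ./ 1)           ∎)
  where
  open import Relation.Binary.Reasoning.Setoid ℚᵘ.≃-setoid
  num≡ : + suc k ≡ + 1 ℤ.* + 1 ℤ.+ + k ℤ.* + 1
  num≡ = ≡.cong (λ i → + 1 ℤ.+ i) (≡.sym (ℤ.*-identityʳ (+ k)))

fromℕ-suc≢0 : ∀ k → + suc k ℚ./ 1 ≢ 0ℚ
fromℕ-suc≢0 k eq with ≡.trans (≡.sym (ℚ.↥-/ (+ suc k) 1))
                        (≡.cong (λ i → i ℤ.* gcd (+ suc k) (+ 1)) (ℚ.p≡0⇒↥p≡0 _ eq))
... | ()

ℚ-noZeroDivisors : ∀ {p q} → p ℚ.* q ≡ 0ℚ → p ≡ 0ℚ ⊎ q ≡ 0ℚ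
ℚ-noZeroDivisors {p} {q} pq≡0 with p ℚ.≟ 0ℚ
... | yes p≡0 = inj₁ p≡0
... | no  p≢0 = inj₂ (begin
  q                           ≡⟨ ℚ.*-identityˡ q ⟨
  1ℚ ℚ.* q                    ≡⟨ ≡.cong (ℚ._* q) (ℚ.*-inverseˡ p) ⟨
  (ℚ.1/ p) ℚ.* p ℚ.* q        ≡⟨ ℚ.*-assoc (ℚ.1/ p) p q ⟩
  (ℚ.1/ p) ℚ.* (p ℚ.* q)      ≡⟨ ≡.cong ((ℚ.1/ p) ℚ.*_) pq≡0 ⟩
  (ℚ.1/ p) ℚ.* 0ℚ             ≡⟨ ℚ.*-zeroʳ (ℚ.1/ p) ⟩
  0ℚ                          ∎)
  where
  open ≡.≡-Reasoning
  instance _ = ℚ.≢-nonZero p≢0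

ℚ-domain : CharZeroDomain
ℚ-domain = record
  { commutativeRing = ℚ.+-*-commutativeRing
  ; noZeroDivisors  = ℚ-noZeroDivisors
  ; ι               = λ k → + k ℚ./ 1
  ; ι-zero          = ≡.refl
  ; ι-suc           = fromℕ-suc
  ; ι≉0             = fromℕ-suc≢0
  }

open UnivariatePolynomials ℚ-domain using (horner; horner-zero; horner-zero⁻¹; zero-product)

horner-⊕ : ∀ p q t → horner (p ⊕ q) t ≡ horner p t ℚ.+ horner q t
horner-⊕ []      q       t = ≡.sym (ℚ.+-identityˡ _)
horner-⊕ (a ∷ p) []      t = ≡.sym (ℚ.+-identityʳ _)
horner-⊕ (a ∷ p) (b ∷ q) t = ≡.trans
  (≡.cong (λ h → a ℚ.+ b ℚ.+ t ℚ.* h) (horner-⊕ p q t))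
  (horner-∷-⊕ a b (horner p t) (horner q t) t)

horner-scaleQ : ∀ c p t → horner (scaleQ c p) t ≡ c ℚ.* horner p t
horner-scaleQ c []      t = ≡.sym (ℚ.*-zeroʳ c)
horner-scaleQ c (a ∷ p) t = ≡.trans
  (≡.cong (λ h → c ℚ.* a ℚ.+ t ℚ.* h) (horner-scaleQ c p t))
  (horner-∷-scale c a t (horner p t))

horner-⊗ : ∀ p q t → horner (p ⊗ q) t ≡ horner p t ℚ.* horner q t
horner-⊗ []      q t = ≡.sym (ℚ.*-zeroˡ (horner q t))
horner-⊗ (a ∷ p) q t = ≡.trans (horner-⊕ (scaleQ a q) (0ℚ ∷ (p ⊗ q)) t) (≡.trans
  (≡.cong₂ (λ g h → g ℚ.+ (0ℚ ℚ.+ t ℚ.* h)) (horner-scaleQ a q t) (horner-⊗ p q t))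
  (horner-∷-⊗ a (horner p t) (horner q t) t))

horner-⊖ : ∀ p t → horner (⊖ p) t ≡ ℚ.- horner p t
horner-⊖ []      t = ≡.refl
horner-⊖ (a ∷ p) t = ≡.trans (≡.cong (λ h → ℚ.- a ℚ.+ t ℚ.* h) (horner-⊖ p t))
  (≡.trans (≡.cong (ℚ.- a ℚ.+_) (≡.sym (ℚ.neg-distribʳ-* t (horner p t))))
    (≡.sym (ℚ.neg-distrib-+ a (t ℚ.* horner p t))))

horner-[] : ∀ c t → horner [ c ] t ≡ c
horner-[] c t = ≡.trans (≡.cong (c ℚ.+_) (ℚ.*-zeroʳ t)) (ℚ.+-identityʳ c)

p-q≡0⇒p≡q : ∀ p q → p ℚ.+ ℚ.- q ≡ 0ℚ → p ≡ q
p-q≡0⇒p≡q p q = x∙y⁻¹≈ε⇒x≈y p q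
  where open import Algebra.Properties.Group ℚ.+-0-group using (x∙y⁻¹≈ε⇒x≈y)

-- Trailing zeros spoil the ring laws for coefficient lists up to `≡`; equality as functions on ℚ
-- avoids this.
_≗_ : QPoly → QPoly → Set
p ≗ q = ∀ t → horner p t ≡ horner q t

horner-difference : ∀ p q t → horner (p ⊕ ⊖ q) t ≡ horner p t ℚ.+ ℚ.- horner q t
horner-difference p q t = ≡.trans (horner-⊕ p (⊖ q) t) (≡.cong (horner p t ℚ.+_) (horner-⊖ q t))

≗⇒IsZeroQ : ∀ p q → p ≗ q → IsZeroQ (p ⊕ ⊖ q)
≗⇒IsZeroQ p q p≗q = horner-zero⁻¹ (p ⊕ ⊖ q) λ k → ≡.trans (horner-difference p q _)
  (≡.trans (≡.cong (ℚ._+ _) (p≗q _)) (ℚ.+-inverseʳ (horner q _)))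

IsZeroQ⇒≗ : ∀ p q → IsZeroQ (p ⊕ ⊖ q) → p ≗ q
IsZeroQ⇒≗ p q z≡0 t = p-q≡0⇒p≡q _ _ (≡.trans (≡.sym (horner-difference p q t)) (horner-zero z≡0 t))

toQ-nonzero : ∀ f → ¬ IsZeroQ (toQ f)
toQ-nonzero f z≡0 with All.++⁻ʳ (NZ.low f) z≡0
... | lead≡0 ∷ [] = NZ.lead≢0 f lead≡0

⊗-zero : ∀ p q → (∀ t → horner p t ℚ.* horner q t ≡ 0ℚ) → IsZeroQ p ⊎ IsZeroQ q
⊗-zero p q pq≡0 = zero-product 0 p q ≡.refl ≡.refl (λ k → pq≡0 _)

prodNZ-nonzero : ∀ D → ¬ IsZeroQ (prodNZ D)
prodNZ-nonzero []      (() ∷ [])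
prodNZ-nonzero (f ∷ D) z≡0 with ⊗-zero (toQ f) (prodNZ D)
                                  (λ t → ≡.trans (≡.sym (horner-⊗ (toQ f) (prodNZ D) t)) (horner-zero z≡0 t))
... | inj₁ f≡0 = toQ-nonzero f f≡0
... | inj₂ D≡0 = prodNZ-nonzero D D≡0

horner-prodNZ-++ : ∀ D E t →
  horner (prodNZ (D ++ E)) t ≡ horner (prodNZ D) t ℚ.* horner (prodNZ E) t
horner-prodNZ-++ []      E t = ≡.sym (≡.trans (≡.cong (ℚ._* horner (prodNZ E) t) (horner-[] 1ℚ t))
  (ℚ.*-identityˡ _))
horner-prodNZ-++ (f ∷ D) E t = begin
  horner (toQ f ⊗ prodNZ (D ++ E)) t                    ≡⟨ horner-⊗ (toQ f) (prodNZ (D ++ E)) t ⟩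
  horner (toQ f) t ℚ.* horner (prodNZ (D ++ E)) t
    ≡⟨ ≡.cong (horner (toQ f) t ℚ.*_) (horner-prodNZ-++ D E t) ⟩
  horner (toQ f) t ℚ.* (horner (prodNZ D) t ℚ.* horner (prodNZ E) t)
    ≡⟨ ℚ.*-assoc (horner (toQ f) t) (horner (prodNZ D) t) (horner (prodNZ E) t) ⟨
  horner (toQ f) t ℚ.* horner (prodNZ D) t ℚ.* horner (prodNZ E) t
    ≡⟨ ≡.cong (ℚ._* horner (prodNZ E) t) (horner-⊗ (toQ f) (prodNZ D) t) ⟨
  horner (toQ f ⊗ prodNZ D) t ℚ.* horner (prodNZ E) t   ∎
  where open ≡.≡-Reasoning

-- An identity in ℚ(r) is tested by specialising r to every t ∈ ℚ, with denominators cleared.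
numAt denAt : 𝔽 → ℚ → ℚ
numAt x t = horner (𝔽.num x) t
denAt x t = horner (prodNZ (𝔽.den x)) t

≈⇒at : ∀ x y → x ≈ y → ∀ t → numAt x t ℚ.* denAt y t ≡ numAt y t ℚ.* denAt x t
≈⇒at x y x≈y t = begin
  numAt x t ℚ.* denAt y t                   ≡⟨ horner-⊗ (𝔽.num x) (prodNZ (𝔽.den y)) t ⟨
  horner (𝔽.num x ⊗ prodNZ (𝔽.den y)) t     ≡⟨ IsZeroQ⇒≗ (𝔽.num x ⊗ prodNZ (𝔽.den y)) (𝔽.num y ⊗ prodNZ (𝔽.den x)) x≈y t ⟩
  horner (𝔽.num y ⊗ prodNZ (𝔽.den x)) t     ≡⟨ horner-⊗ (𝔽.num y) (prodNZ (𝔽.den x)) t ⟩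
  numAt y t ℚ.* denAt x t                   ∎
  where open ≡.≡-Reasoning

at⇒≈ : ∀ x y → (∀ t → numAt x t ℚ.* denAt y t ≡ numAt y t ℚ.* denAt x t) → x ≈ y
at⇒≈ x y eq = ≗⇒IsZeroQ (𝔽.num x ⊗ prodNZ (𝔽.den y)) (𝔽.num y ⊗ prodNZ (𝔽.den x)) λ t → begin
  horner (𝔽.num x ⊗ prodNZ (𝔽.den y)) t     ≡⟨ horner-⊗ (𝔽.num x) (prodNZ (𝔽.den y)) t ⟩
  numAt x t ℚ.* denAt y t                   ≡⟨ eq t ⟩
  numAt y t ℚ.* denAt x t                   ≡⟨ horner-⊗ (𝔽.num y) (prodNZ (𝔽.den x)) t ⟨
  horner (𝔽.num y ⊗ prodNZ (𝔽.den x)) t     ∎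
  where open ≡.≡-Reasoning

-- The denominator value `m` may be 0: only cross-multiplied identities are used, so poles need no
-- separate treatment.
record At (t : ℚ) (x : 𝔽) (a m : ℚ) : Set where
  constructor at
  field
    num≡ : numAt x t ≡ a
    den≡ : denAt x t ≡ m

at-self : ∀ t x → At t x (numAt x t) (denAt x t)
at-self t x = at ≡.refl ≡.refl

at-constant : ∀ t c → At t ([ c ] ⁄ []) c 1ℚ
at-constant t c = at (horner-[] c t) (horner-[] 1ℚ t)

at-0F : ∀ t → At t 0F 0ℚ 1ℚ
at-0F t = at ≡.refl (horner-[] 1ℚ t)

at-+ : ∀ {t x y a m b k} → At t x a m → At t y b k → At t (x +F y) (a ℚ.* k ℚ.+ b ℚ.* m) (m ℚ.* k)
at-+ {t} {a₁ ⁄ D} {b₁ ⁄ E} (at ≡.refl ≡.refl) (at ≡.refl ≡.refl) = at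
  (≡.trans (horner-⊕ (a₁ ⊗ prodNZ E) (b₁ ⊗ prodNZ D) t)
    (≡.cong₂ ℚ._+_ (horner-⊗ a₁ (prodNZ E) t) (horner-⊗ b₁ (prodNZ D) t)))
  (horner-prodNZ-++ D E t)

at-* : ∀ {t x y a m b k} → At t x a m → At t y b k → At t (x *F y) (a ℚ.* b) (m ℚ.* k)
at-* {t} {a₁ ⁄ D} {b₁ ⁄ E} (at ≡.refl ≡.refl) (at ≡.refl ≡.refl) =
  at (horner-⊗ a₁ b₁ t) (horner-prodNZ-++ D E t)

at-neg : ∀ {t x a m} → At t x a m → At t (-F x) (ℚ.- a) m
at-neg {t} {a₁ ⁄ D} (at ≡.refl ≡.refl) = at (horner-⊖ a₁ t) ≡.refl

cross : ∀ {t x y a m b k} → At t x a m → At t y b k → a ℚ.* k ≡ b ℚ.* m →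
  numAt x t ℚ.* denAt y t ≡ numAt y t ℚ.* denAt x t
cross (at ≡.refl ≡.refl) (at ≡.refl ≡.refl) eq = eq

at-zero : ∀ x {t a m} → x ≈ 0F → At t x a m → a ≡ 0ℚ
at-zero x {t} {a} {m} x≈0 (at ≡.refl ≡.refl) = begin
  a                   ≡⟨ ℚ.*-identityʳ a ⟨
  a ℚ.* 1ℚ            ≡⟨ ≡.cong (a ℚ.*_) (horner-[] 1ℚ t) ⟨
  a ℚ.* denAt 0F t    ≡⟨ ≈⇒at x 0F x≈0 t ⟩
  0ℚ ℚ.* m            ≡⟨ ℚ.*-zeroˡ m ⟩
  0ℚ                  ∎
  where open ≡.≡-Reasoning

num-zero : ∀ x → IsZeroQ (𝔽.num x) → x ≈ 0F
num-zero x z≡0 = at⇒≈ x 0F λ t → cross (at-self t x) (at-0F t)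
  (≡.trans (≡.cong (ℚ._* 1ℚ) (horner-zero z≡0 t)) (≡.sym (ℚ.*-zeroˡ (denAt x t))))

≈F-refl : ∀ x → x ≈ x
≈F-refl x = at⇒≈ x x λ t → ≡.refl

≈F-sym : ∀ x y → x ≈ y → y ≈ x
≈F-sym x y x≈y = at⇒≈ y x λ t → ≡.sym (≈⇒at x y x≈y t)

-- Cross-multiplication yields the desired identity only up to the factor `denAt y t`, which may be
-- 0 for some `t`. The cancellation therefore takes place between polynomials, where the denominator
-- of `y` is nonzero.
≈F-trans : ∀ x y z → x ≈ y → y ≈ z → x ≈ z
≈F-trans x y z x≈y y≈z = Sum.[ (λ k≡0 → ⊥-elim (prodNZ-nonzero (𝔽.den y) k≡0)) , id ]′
  (⊗-zero (prodNZ (𝔽.den y)) (p ⊕ ⊖ q) vanish)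
  where
  p = 𝔽.num x ⊗ prodNZ (𝔽.den z)
  q = 𝔽.num z ⊗ prodNZ (𝔽.den x)
  vanish : ∀ t → denAt y t ℚ.* horner (p ⊕ ⊖ q) t ≡ 0ℚ
  vanish t = begin
    k ℚ.* horner (p ⊕ ⊖ q) t
      ≡⟨ ≡.cong (k ℚ.*_) (horner-difference p q t) ⟩
    k ℚ.* (horner p t ℚ.+ ℚ.- horner q t)
      ≡⟨ ℚ.*-distribˡ-+ k (horner p t) (ℚ.- horner q t) ⟩
    k ℚ.* horner p t ℚ.+ k ℚ.* ℚ.- horner q t
      ≡⟨ ≡.cong₂ (λ g h → g ℚ.+ h) kp≡kq (≡.sym (ℚ.neg-distribʳ-* k (horner q t))) ⟩
    k ℚ.* horner q t ℚ.+ ℚ.- (k ℚ.* horner q t)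
      ≡⟨ ℚ.+-inverseʳ (k ℚ.* horner q t) ⟩
    0ℚ ∎
    where
    open ≡.≡-Reasoning
    a = numAt x t ; m = denAt x t
    b = numAt y t ; k = denAt y t
    c = numAt z t ; l = denAt z t
    kp≡kq : k ℚ.* horner p t ≡ k ℚ.* horner q t
    kp≡kq = begin
      k ℚ.* horner p t      ≡⟨ ≡.cong (k ℚ.*_) (horner-⊗ (𝔽.num x) (prodNZ (𝔽.den z)) t) ⟩
      k ℚ.* (a ℚ.* l)       ≡⟨ rotate₃ k a l ⟩
      (a ℚ.* k) ℚ.* l       ≡⟨ ≡.cong (ℚ._* l) (≈⇒at x y x≈y t) ⟩
      (b ℚ.* m) ℚ.* l       ≡⟨ swap-right b m l ⟩
      (b ℚ.* l) ℚ.* m       ≡⟨ ≡.cong (ℚ._* m) (≈⇒at y z y≈z t) ⟩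
      (c ℚ.* k) ℚ.* m       ≡⟨ swap-right c k m ⟩
      (c ℚ.* m) ℚ.* k       ≡⟨ ℚ.*-comm (c ℚ.* m) k ⟩
      k ℚ.* (c ℚ.* m)       ≡⟨ ≡.cong (k ℚ.*_) (horner-⊗ (𝔽.num z) (prodNZ (𝔽.den x)) t) ⟨
      k ℚ.* horner q t      ∎

+F-cong : ∀ x x′ y y′ → x ≈ x′ → y ≈ y′ → x +F y ≈ x′ +F y′
+F-cong x x′ y y′ x≈x′ y≈y′ = at⇒≈ (x +F y) (x′ +F y′) λ t →
  cross (at-+ (at-self t x) (at-self t y)) (at-+ (at-self t x′) (at-self t y′))
    (≡.trans (fraction-+-split (numAt x t) (denAt x t) (numAt y t) (denAt y t) (denAt x′ t) (denAt y′ t))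
      (≡.trans
        (≡.cong₂ (λ g h → g ℚ.* (denAt y t ℚ.* denAt y′ t) ℚ.+ h ℚ.* (denAt x t ℚ.* denAt x′ t))
          (≈⇒at x x′ x≈x′ t) (≈⇒at y y′ y≈y′ t))
        (fraction-+-merge (numAt x′ t) (denAt x′ t) (numAt y′ t) (denAt y′ t) (denAt x t) (denAt y t))))

*F-cong : ∀ x x′ y y′ → x ≈ x′ → y ≈ y′ → x *F y ≈ x′ *F y′
*F-cong x x′ y y′ x≈x′ y≈y′ = at⇒≈ (x *F y) (x′ *F y′) λ t →
  cross (at-* (at-self t x) (at-self t y)) (at-* (at-self t x′) (at-self t y′))
    (≡.trans (*-interchange (numAt x t) (numAt y t) (denAt x′ t) (denAt y′ t))
      (≡.trans (≡.cong₂ ℚ._*_ (≈⇒at x x′ x≈x′ t) (≈⇒at y y′ y≈y′ t))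
        (≡.sym (*-interchange (numAt x′ t) (numAt y′ t) (denAt x t) (denAt y t)))))

-F-cong : ∀ x y → x ≈ y → -F x ≈ -F y
-F-cong x y x≈y = at⇒≈ (-F x) (-F y) λ t →
  cross (at-neg (at-self t x)) (at-neg (at-self t y))
    (≡.trans (≡.sym (ℚ.neg-distribˡ-* (numAt x t) (denAt y t)))
      (≡.trans (≡.cong ℚ.-_ (≈⇒at x y x≈y t)) (ℚ.neg-distribˡ-* (numAt y t) (denAt x t))))

+F-assoc : ∀ x y z → (x +F y) +F z ≈ x +F (y +F z)
+F-assoc x y z = at⇒≈ ((x +F y) +F z) (x +F (y +F z)) λ t →
  cross (at-+ (at-+ (at-self t x) (at-self t y)) (at-self t z))
        (at-+ (at-self t x) (at-+ (at-self t y) (at-self t z)))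
    (fraction-+-assoc (numAt x t) (denAt x t) (numAt y t) (denAt y t) (numAt z t) (denAt z t))

+F-comm : ∀ x y → x +F y ≈ y +F x
+F-comm x y = at⇒≈ (x +F y) (y +F x) λ t →
  cross (at-+ (at-self t x) (at-self t y)) (at-+ (at-self t y) (at-self t x))
    (fraction-+-comm (numAt x t) (denAt x t) (numAt y t) (denAt y t))

+F-identityˡ : ∀ x → 0F +F x ≈ x
+F-identityˡ x = at⇒≈ (0F +F x) x λ t →
  cross (at-+ (at-0F t) (at-self t x)) (at-self t x)
    (fraction-+-identityˡ (numAt x t) (denAt x t))

-F-inverseˡ : ∀ x → (-F x) +F x ≈ 0F
-F-inverseˡ x = at⇒≈ ((-F x) +F x) 0F λ t →
  cross (at-+ (at-neg (at-self t x)) (at-self t x)) (at-0F t) (begin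
    ((ℚ.- numAt x t) ℚ.* denAt x t ℚ.+ numAt x t ℚ.* denAt x t) ℚ.* 1ℚ
      ≡⟨ ≡.cong (ℚ._* 1ℚ) (≡.sym (ℚ.*-distribʳ-+ (denAt x t) (ℚ.- numAt x t) (numAt x t))) ⟩
    ((ℚ.- numAt x t ℚ.+ numAt x t) ℚ.* denAt x t) ℚ.* 1ℚ
      ≡⟨ ≡.cong (λ s → (s ℚ.* denAt x t) ℚ.* 1ℚ) (ℚ.+-inverseˡ (numAt x t)) ⟩
    (0ℚ ℚ.* denAt x t) ℚ.* 1ℚ
      ≡⟨ ≡.cong (ℚ._* 1ℚ) (ℚ.*-zeroˡ (denAt x t)) ⟩
    0ℚ ℚ.* 1ℚ
      ≡⟨ ≡.trans (ℚ.*-zeroˡ 1ℚ) (≡.sym (ℚ.*-zeroˡ (denAt x t ℚ.* denAt x t))) ⟩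
    0ℚ ℚ.* (denAt x t ℚ.* denAt x t) ∎)
  where open ≡.≡-Reasoning

*F-assoc : ∀ x y z → (x *F y) *F z ≈ x *F (y *F z)
*F-assoc x y z = at⇒≈ ((x *F y) *F z) (x *F (y *F z)) λ t →
  cross (at-* (at-* (at-self t x) (at-self t y)) (at-self t z))
        (at-* (at-self t x) (at-* (at-self t y) (at-self t z)))
    (fraction-*-assoc (numAt x t) (denAt x t) (numAt y t) (denAt y t) (numAt z t) (denAt z t))

*F-comm : ∀ x y → x *F y ≈ y *F x
*F-comm x y = at⇒≈ (x *F y) (y *F x) λ t →
  cross (at-* (at-self t x) (at-self t y)) (at-* (at-self t y) (at-self t x))
    (fraction-*-comm (numAt x t) (denAt x t) (numAt y t) (denAt y t))

*F-identityˡ : ∀ x → 1F *F x ≈ x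
*F-identityˡ x = at⇒≈ (1F *F x) x λ t →
  cross (at-* (at-constant t 1ℚ) (at-self t x)) (at-self t x)
    (≡.trans (≡.cong (ℚ._* denAt x t) (ℚ.*-identityˡ (numAt x t)))
      (≡.cong (numAt x t ℚ.*_) (≡.sym (ℚ.*-identityˡ (denAt x t)))))

*F-distribˡ-+F : ∀ x y z → x *F (y +F z) ≈ (x *F y) +F (x *F z)
*F-distribˡ-+F x y z = at⇒≈ (x *F (y +F z)) ((x *F y) +F (x *F z)) λ t →
  cross (at-* (at-self t x) (at-+ (at-self t y) (at-self t z)))
        (at-+ (at-* (at-self t x) (at-self t y)) (at-* (at-self t x) (at-self t z)))
    (fraction-distrib (numAt x t) (denAt x t) (numAt y t) (denAt y t) (numAt z t) (denAt z t))

𝔽-setoid : Setoid 0ℓ 0ℓ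
𝔽-setoid = record
  { Carrier = 𝔽
  ; _≈_ = _≈_
  ; isEquivalence = record
    { refl = λ {x} → ≈F-refl x
    ; sym = λ {x} {y} → ≈F-sym x y
    ; trans = λ {x} {y} {z} → ≈F-trans x y z
    }
  }

𝔽-commutativeRing : CommutativeRing 0ℓ 0ℓ
𝔽-commutativeRing = record
  { Carrier = 𝔽 ; _≈_ = _≈_ ; _+_ = _+F_ ; _*_ = _*F_ ; -_ = -F_ ; 0# = 0F ; 1# = 1F
  ; isCommutativeRing = record
    { isRing = record
      { +-isAbelianGroup = record
        { isGroup = record
          { isMonoid = record
            { isSemigroup = record
              { isMagma = record
                { isEquivalence = Setoid.isEquivalence 𝔽-setoid
                ; ∙-cong = λ {x} {x′} {y} {y′} → +F-cong x x′ y y′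
                }
              ; assoc = +F-assoc
              }
            ; identity = comm∧idˡ⇒id {_+F_} +F-comm {0F} +F-identityˡ
            }
          ; inverse = comm∧invˡ⇒inv {_+F_} {λ x → -F x} {0F} +F-comm -F-inverseˡ
          ; ⁻¹-cong = λ {x} {y} → -F-cong x y
          }
        ; comm = +F-comm
        }
      ; *-cong = λ {x} {x′} {y} {y′} → *F-cong x x′ y y′
      ; *-assoc = *F-assoc
      ; *-identity = comm∧idˡ⇒id {_*F_} *F-comm {1F} *F-identityˡ
      ; distrib = comm∧distrˡ⇒distr {_*F_} {_+F_} (λ {x} {x′} {y} {y′} → +F-cong x x′ y y′) *F-comm *F-distribˡ-+F
      }
    ; *-comm = *F-comm
    }
  }
  where
  open import Algebra.Consequences.Setoid 𝔽-setoid
    using (comm∧idˡ⇒id; comm∧invˡ⇒inv; comm∧distrˡ⇒distr)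

𝔽-noZeroDivisors : ∀ x y → x *F y ≈ 0F → x ≈ 0F ⊎ y ≈ 0F
𝔽-noZeroDivisors x y xy≈0 = Sum.map (num-zero x) (num-zero y)
  (⊗-zero (𝔽.num x) (𝔽.num y)
    λ t → at-zero (x *F y) xy≈0 (at-* {t} {x} {y} (at-self t x) (at-self t y)))

constant : ℚ → 𝔽
constant c = [ c ] ⁄ []

constant-cong : ∀ {a b} → a ≡ b → constant a ≈ constant b
constant-cong {a} ≡.refl = ≈F-refl (constant a)

constant-+ : ∀ a b → constant (a ℚ.+ b) ≈ constant a +F constant b
constant-+ a b = at⇒≈ (constant (a ℚ.+ b)) (constant a +F constant b) λ t →
  cross {t} {constant (a ℚ.+ b)} {constant a +F constant b}
    (at-constant t (a ℚ.+ b))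
    (at-+ {t} {constant a} {constant b} (at-constant t a) (at-constant t b))
    (≡.cong (ℚ._* (1ℚ ℚ.* 1ℚ)) (≡.sym (≡.cong₂ ℚ._+_ (ℚ.*-identityʳ a) (ℚ.*-identityʳ b))))

constant≉0 : ∀ {c} → c ≢ 0ℚ → ¬ constant c ≈ 0F
constant≉0 {c} c≢0 eq = c≢0 (at-zero (constant c) eq (at-constant 0ℚ c))

horner-at-0 : ∀ a p → horner (a ∷ p) 0ℚ ≡ a
horner-at-0 a p = ≡.trans (≡.cong (a ℚ.+_) (ℚ.*-zeroˡ (horner p 0ℚ))) (ℚ.+-identityʳ a)

at-rF : At 0ℚ rF 0ℚ 1ℚ
at-rF = at (horner-at-0 0ℚ [ 1ℚ ]) (horner-[] 1ℚ 0ℚ)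

at-αF : At 0ℚ αF 1ℚ 0ℚ
at-αF = at (horner-[] 1ℚ 0ℚ) (≡.trans (horner-⊗ (toQ rNZ) [ 1ℚ ] 0ℚ)
  (≡.trans (≡.cong (ℚ._* horner [ 1ℚ ] 0ℚ) (horner-at-0 0ℚ [ 1ℚ ])) (ℚ.*-zeroˡ (horner [ 1ℚ ] 0ℚ))))

-- At `r = 0` the numerator is `a`.
a+rb≉0 : ∀ a b → a ≢ 0ℚ → ¬ constant a +F rF *F constant b ≈ 0F
a+rb≉0 a b a≢0 eq = a≢0 (≡.trans (≡.sym simplify)
  (at-zero (constant a +F rF *F constant b) eq
    (at-+ {0ℚ} {constant a} {rF *F constant b} (at-constant 0ℚ a)
      (at-* {0ℚ} {rF} {constant b} at-rF (at-constant 0ℚ b)))))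
  where
  simplify : a ℚ.* (1ℚ ℚ.* 1ℚ) ℚ.+ (0ℚ ℚ.* b) ℚ.* 1ℚ ≡ a
  simplify = ≡.trans (≡.cong₂ ℚ._+_ (ℚ.*-identityʳ a)
    (≡.trans (ℚ.*-identityʳ (0ℚ ℚ.* b)) (ℚ.*-zeroˡ b))) (ℚ.+-identityʳ a)

-- As a fraction this is `(a + r b) / r`, whose numerator at `r = 0` is `a`; the pole there does no
-- harm.
αa+b≉0 : ∀ a b → a ≢ 0ℚ → ¬ αF *F constant a +F constant b ≈ 0F
αa+b≉0 a b a≢0 eq = a≢0 (≡.trans (≡.sym simplify)
  (at-zero (αF *F constant a +F constant b) eq
    (at-+ {0ℚ} {αF *F constant a} {constant b}
      (at-* {0ℚ} {αF} {constant a} at-αF (at-constant 0ℚ a)) (at-constant 0ℚ b))))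
  where
  simplify : (1ℚ ℚ.* a) ℚ.* 1ℚ ℚ.+ b ℚ.* (0ℚ ℚ.* 1ℚ) ≡ a
  simplify = ≡.trans (≡.cong₂ ℚ._+_ (≡.trans (ℚ.*-identityʳ (1ℚ ℚ.* a)) (ℚ.*-identityˡ a))
    (ℚ.*-zeroʳ b)) (ℚ.+-identityʳ a)

ℕ→F-suc : ∀ k → ℕ→F (suc k) ≈ 1F +F ℕ→F k
ℕ→F-suc k = ≈F-trans (ℕ→F (suc k)) (constant (1ℚ ℚ.+ + k ℚ./ 1)) (1F +F ℕ→F k)
  (constant-cong (fromℕ-suc k)) (constant-+ 1ℚ (+ k ℚ./ 1))

ℕ+rℕ≉0 : ∀ k m → ¬ ℕ→F (suc k) +F rF *F ℕ→F m ≈ 0F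
ℕ+rℕ≉0 k m = a+rb≉0 (+ suc k ℚ./ 1) (+ m ℚ./ 1) (fromℕ-suc≢0 k)

αℕ+ℕ≉0 : ∀ k m → ¬ αF *F ℕ→F (suc k) +F ℕ→F m ≈ 0F
αℕ+ℕ≉0 k m = αa+b≉0 (+ suc k ℚ./ 1) (+ m ℚ./ 1) (fromℕ-suc≢0 k)

𝔽-domain : CharZeroDomain
𝔽-domain = record
  { commutativeRing = 𝔽-commutativeRing
  ; noZeroDivisors  = λ {x} {y} → 𝔽-noZeroDivisors x y
  ; ι               = ℕ→F
  ; ι-zero          = num-zero (ℕ→F 0) (≡.refl ∷ [])
  ; ι-suc           = ℕ→F-suc
  ; ι≉0             = λ k → constant≉0 (fromℕ-suc≢0 k)
  }

prodF-nonzero : ∀ xs → All (λ x → ¬ x ≈ 0F) xs → ¬ prodF xs ≈ 0F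
prodF-nonzero []       []           = constant≉0 {1ℚ} 1≢0
prodF-nonzero (x ∷ xs) (x≉0 ∷ xs≉0) eq =
  Sum.[ x≉0 , prodF-nonzero xs xs≉0 ]′ (𝔽-noZeroDivisors x (prodF xs) eq)

dη≉0 : ∀ {n} (η : Vec ℕ n) → ¬ dη η ≈ 0F
dη≉0 {n} η = prodF-nonzero _ (All.concat⁺ (All.map⁺ (All.universal
  (λ i → All.map⁺ (All.universal (λ j₀ → αℕ+ℕ≉0 (armη η i (suc j₀)) (suc (legη η i (suc j₀))))
    (upTo (Vec.lookup η i))))
  (allFin n))))

-- Denominators in `𝔽` must exhibit a nonzero leading coefficient, so trailing zeros are removed
-- before a numerator can be inverted.
strip : ∀ p → IsZeroQ p ⊎ (Σ[ f ∈ NZ ] ∀ t → horner (toQ f) t ≡ horner p t)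
strip []      = inj₁ []
strip (a ∷ p) with strip p
... | inj₂ (f , f≗p) = inj₂ (record { low = a ∷ NZ.low f ; lead = NZ.lead f ; lead≢0 = NZ.lead≢0 f } ,
  λ t → ≡.cong (λ h → a ℚ.+ t ℚ.* h) (f≗p t))
... | inj₁ p≡0 with a ℚ.≟ 0ℚ
...   | yes a≡0 = inj₁ (a≡0 ∷ p≡0)
...   | no  a≢0 = inj₂ (record { low = [] ; lead = a ; lead≢0 = a≢0 } ,
  λ t → ≡.cong (λ h → a ℚ.+ t ℚ.* h) (≡.sym (horner-zero p≡0 t)))

𝔽-inverse : ∀ x → ¬ x ≈ 0F → ∃ λ y → y *F x ≈ 1F
𝔽-inverse x x≉0 with strip (𝔽.num x)
... | inj₁ num≡0 = ⊥-elim (x≉0 (num-zero x num≡0))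
... | inj₂ (f , f≗num) = y , at⇒≈ (y *F x) 1F λ t →
  cross {t} {y *F x} {1F} (at-* {t} {y} {x} (at-y t) (at-self t x)) (at-constant t 1ℚ) (begin
    (denAt x t ℚ.* numAt x t) ℚ.* 1ℚ   ≡⟨ ℚ.*-identityʳ (denAt x t ℚ.* numAt x t) ⟩
    denAt x t ℚ.* numAt x t            ≡⟨ ℚ.*-comm (denAt x t) (numAt x t) ⟩
    numAt x t ℚ.* denAt x t            ≡⟨ ℚ.*-identityˡ (numAt x t ℚ.* denAt x t) ⟨
    1ℚ ℚ.* (numAt x t ℚ.* denAt x t)   ∎)
  where
  open ≡.≡-Reasoning
  y : 𝔽
  y = prodNZ (𝔽.den x) ⁄ [ f ]
  at-y : ∀ t → At t y (denAt x t) (numAt x t)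
  at-y t = at ≡.refl (≡.trans (horner-⊗ (toQ f) [ 1ℚ ] t)
    (≡.trans (≡.cong₂ ℚ._*_ (f≗num t) (horner-[] 1ℚ t)) (ℚ.*-identityʳ (numAt x t))))

𝔽-generic : GenericParameter 𝔽-domain
𝔽-generic = record { r = rF ; ι+rι≉0 = ℕ+rℕ≉0 }

-- Transfer to the concrete definitions and the theorem.

module 𝔽-Polynomials = Polynomials 𝔽-domain

powF≡pow : ∀ x k → powF x k ≡ 𝔽-Polynomials.pow x k
powF≡pow x zero    = ≡.refl
powF≡pow x (suc k) = ≡.cong (x *F_) (powF≡pow x k)

evalMon≡evalMon′ : ∀ {n} (x : Vec 𝔽 n) μ → evalMon x μ ≡ 𝔽-Polynomials.evalMon x μ
evalMon≡evalMon′ []      []      = ≡.refl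
evalMon≡evalMon′ (a ∷ x) (k ∷ μ) = ≡.cong₂ _*F_ (powF≡pow a k) (evalMon≡evalMon′ x μ)

eval≡eval′ : ∀ {n} (p : Poly n) x → eval p x ≡ 𝔽-Polynomials.eval p x
eval≡eval′ []            x = ≡.refl
eval≡eval′ ((μ , c) ∷ p) x = ≡.cong₂ _+F_ (≡.cong (c *F_) (evalMon≡evalMon′ x μ)) (eval≡eval′ p x)

Frδ≡Frδ′ : ∀ {n} (E : Vec ℕ n → Poly n) η →
  Frδ E η ≡ 𝔽-Polynomials.scaleP (𝔽-Polynomials.sign ∣ η ∣ *F dη η) (𝔽-Polynomials.negArg (E η))
Frδ≡Frδ′ E η = ≡.cong₂ scaleP
  (≡.cong (_*F dη η) (powF≡pow (-F 1F) ∣ η ∣))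
  (map-cong (λ t → ≡.cong (λ s → proj₁ t , s *F proj₂ t) (powF≡pow (-F 1F) ∣ proj₁ t ∣)) (E η))

theorem3p8 : (n : ℕ) → 1 ≤ n
    → (E : Vec ℕ n → Poly n) → (∀ η → IsInterp η (E η))
    → (Ξ : Poly n → Poly n) → IsLinear Ξ → (∀ η → Ξ (Fα E η) ≈P Frδ E η)
    → (d : ℕ) (f : Poly n) → IsHomog d f
    → (DegLt d (Ξ f -P f) × (∀ (η : Vec ℕ n) → ∣ η ∣ < d → eval (Ξ f) (negV (bar η)) ≈ 0F))
      × (∀ (g : Poly n) → DegLt d (g -P f)
           → (∀ (η : Vec ℕ n) → ∣ η ∣ < d → eval g (negV (bar η)) ≈ 0F)
           → g ≈P Ξ f)
theorem3p8 n _ E interp Ξ linear Ξ-F d f hom =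
  (proj₁ (proj₁ result) ,
    (λ η η<d → ≡.subst (_≈ 0F) (≡.sym (eval≡eval′ (Ξ f) (negV (bar η)))) (proj₂ (proj₁ result) η η<d))) ,
  (λ g g-f<d g-vanish → proj₂ result g g-f<d
    (λ η η<d → ≡.subst (_≈ 0F) (eval≡eval′ g (negV (bar η))) (g-vanish η η<d)))
  where
  open IsLinear linear
  open Interpolation 𝔽-domain 𝔽-generic
  open Characterization 𝔽-inverse E
    (λ η → proj₁ (interp η)) (λ η → proj₁ (proj₂ (interp η)))
    (λ η γ γ≢η γ≤η → ≡.subst (_≈ 0F) (eval≡eval′ (E η) (bar γ)) (proj₂ (proj₂ (interp η)) γ γ≢η γ≤η))
    dη dη≉0 Ξ cong additive homog
    (λ η → ≡.subst (Ξ (Fα E η) ≈P_) (Frδ≡Frδ′ E η) (Ξ-F η))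
    using (characterization)
  result = characterization d f hom
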